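{- Fix a signature and isdef-formulas $\delta$ on it, let $\Gamma$ be a set of formulas and $\varphi$ a formula. (1) If $\Gamma\not\vdash\mathsf{F}$, then $(\delta,\Gamma)$ has a model. (2) If $\Gamma\models\varphi$, then $\Gamma\vdash\varphi$.
   Context: Syntax: a signature has countable sets of constant, function and relation symbols with positive integer arities; variables $\mathtt{v}_1,\mathtt{v}_2,\dots$ (countably infinitely many). Terms: variables, constants, $f(t_1,\dots,t_n)$. Atomic formulas: $\mathsf{F}$, $\mathsf{T}$, $(t_1=t_2)$, $R(t_1,\dots,t_n)$. Formulas use $\neg,\wedge,\vee,\forall x,\exists x$ only; $\wedge,\vee$ associate to the left. $\varphi(t)$ replaces every free occurrence of $x$ in $\varphi(x)$ by $t$; $t$ is free for $x$ in $\varphi(x)$ if no variable of $t$ becomes bound in $\varphi(t)$. Semantics: a structure $\sigma$ has a nonempty domain $\mathbb{D}$, elements for constants, partial functions $\mathbb{D}^n\to\mathbb{D}$ for $n$-ary function symbols, subsets of $\mathbb{D}^n$ for relation symbols; an assignment is $\nu:\mathbb{Z}^+\to\mathbb{D}$, $\nu(\mathtt{v}_i)=\nu(i)$, $\nu[x:=d]$ changes the value of $x$ to $d$. A compound term is defined iff all arguments are defined and the function is defined at their values. Truth values in $\{\mathsf{F},\mathsf{U},\mathsf{T}\}$ ordered $\mathsf{F}<\mathsf{U}<\mathsf{T}$: $\mathsf{F},\mathsf{T}$ denote themselves; equality/relation atoms are $\mathsf{U}$ if some argument term is undefined, else classical $\mathsf{T}$/$\mathsf{F}$; $\neg$ swaps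 $\mathsf{F},\mathsf{T}$ and fixes $\mathsf{U}$; $\wedge$ min, $\vee$ max; $\forall x\,\varphi$ min and $\exists x\,\varphi$ max of the value of $\varphi$ under $\nu[x:=d]$ over $d\in\mathbb{D}$. Isdef-formulas $\delta$: for each $n$-ary function symbol $f$ a formula $\delta_f$ with free variables among $\mathtt{v}_1,\dots,\mathtt{v}_n$, such that $\delta_g$ is literally $\mathsf{T}$ for every function symbol $g$ occurring in $\delta_f$. $\sigma\models\delta$ iff for all $f$ and $d_1,\dots,d_n\in\mathbb{D}$: $\delta_f$ has value $\mathsf{T}$ under assignments with $\mathtt{v}_i\mapsto d_i$ iff $f$'s interpretation is defined at $(d_1,\dots,d_n)$. A model of $(\delta,\Gamma)$ is a pair $(\sigma,\nu)$ with $\sigma\models\delta$ and every formula of $\Gamma$ having value $\mathsf{T}$; $\Gamma\models\varphi$ iff every model of $(\delta,\Gamma)$ gives $\varphi$ value $\mathsf{T}$. $\mathrm{Def}$ (syntactic operation producing formulas): $\mathrm{Def}(x)=\mathrm{Def}(c)=\mathsf{T}$; $\mathrm{Def}(f(t_1,\dots,t_n))=\mathrm{Def}(t_1)\wedge\cdots\wedge\mathrm{Def}(t_n)\wedge\delta_f(t_1,\dots,t_n)$ ($\delta_f$ with bound variables renamed so each $t_i$ is free for $\mathtt{v}_i$, then $t_i$ substituted for free $\mathtt{v}_i$); $\mathrm{Def}(\mathsf{F})=\mathrm{Def}(\mathsf{T})=\mathsf{T}$; $\mathrm{Def}(t_1=t_2)=\mathrm{Def}(t_1)\wedge\mathrm{Def}(t_2)$;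 $\mathrm{Def}(R(t_1,\dots,t_n))=\mathrm{Def}(t_1)\wedge\cdots\wedge\mathrm{Def}(t_n)$; $\mathrm{Def}(\neg\varphi)=\mathrm{Def}(\varphi)$; $\mathrm{Def}(\varphi\wedge\psi)=(\mathrm{Def}(\varphi)\wedge\mathrm{Def}(\psi))\vee(\mathrm{Def}(\varphi)\wedge\neg\varphi)\vee(\mathrm{Def}(\psi)\wedge\neg\psi)$; $\mathrm{Def}(\varphi\vee\psi)=(\mathrm{Def}(\varphi)\wedge\mathrm{Def}(\psi))\vee(\mathrm{Def}(\varphi)\wedge\varphi)\vee(\mathrm{Def}(\psi)\wedge\psi)$; $\mathrm{Def}(\forall x\,\varphi)=(\forall x\,\mathrm{Def}(\varphi))\vee\exists x\,(\mathrm{Def}(\varphi)\wedge\neg\varphi)$; $\mathrm{Def}(\exists x\,\varphi)=(\forall x\,\mathrm{Def}(\varphi))\vee\exists x\,(\mathrm{Def}(\varphi)\wedge\varphi)$. Proof system: $\Gamma\vdash\varphi$ is the least relation closed under: P1 $\{\varphi\}\vdash\varphi$; P2 if $\Gamma\vdash\varphi$ then $\Gamma\cup\Delta\vdash\varphi$; P3 if $\Gamma\vdash\varphi$ and $\Gamma\cup\{\varphi\}\vdash\psi$ then $\Gamma\vdash\psi$; C1 $\emptyset\vdash(\varphi\vee\neg\varphi)\vee\neg\mathrm{Def}(\varphi)$; C2 $\{\mathsf{F}\}\vdash\varphi$; C3 $\{\varphi,\neg\varphi\}\vdash\mathsf{F}$; D1 $\{\varphi\}\vdash\mathrm{Def}(\varphi)$;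 $\wedge$-I $\{\varphi,\psi\}\vdash\varphi\wedge\psi$; $\wedge$-E1 $\{\varphi\wedge\psi\}\vdash\varphi$; $\wedge$-E2 $\{\varphi\wedge\psi\}\vdash\psi$; $\vee$-I1 $\{\varphi\}\vdash\varphi\vee\psi$; $\vee$-I2 $\{\psi\}\vdash\varphi\vee\psi$; $\vee$-E if $\Gamma\cup\{\varphi\}\vdash\chi$ and $\Gamma\cup\{\psi\}\vdash\chi$ then $\Gamma\cup\{\varphi\vee\psi\}\vdash\chi$; $=$-1 $\{\mathrm{Def}(t)\}\vdash(t=t)$; $=$-2 if $\varphi(x_1,\dots,x_n)$ is a formula with distinct variables $x_j$, $1\le i\le n$, and $t_i,t'_i$ are free for $x_i$, then $\{(t_i=t'_i),\varphi(t_1,\dots,t_n)\}\vdash\varphi(t_1,\dots,t'_i,\dots,t_n)$; $\forall$-E if $t$ is free for $x$ in $\varphi(x)$ then $\{\mathrm{Def}(t),\forall x\,\varphi(x)\}\vdash\varphi(t)$; $\forall$-I if $\Gamma\vdash\varphi(x)$ and $x$ does not occur free in $\Gamma$ then $\Gamma\vdash\forall x\,\varphi(x)$; $\exists$-I if $t$ is free for $x$ in $\varphi(x)$ then $\{\varphi(t)\}\vdash\exists x\,\varphi(x)$; $\exists$-E if $\Gamma\cup\{\varphi(y)\}\vdash\psi$ and $y$ occurs neither in $\Gamma$, in $\exists x\,\varphi(x)$, nor in $\psi$, then $\Gamma\cup\{\exists x\,\varphi(x)\}\vdash\psi$. $\Gamma\not\vdash\mathsf{F}$ means $\Gamma\vdash\mathsf{F}$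 does not hold. -}

module Defs where

open import Level using (0ℓ)
open import Data.Nat using (ℕ; zero; suc; _≤_; _<_; _⊔_; _≡ᵇ_; _<?_)
open import Data.Fin using (Fin; toℕ; fromℕ<)
open import Data.Vec using (Vec; []; _∷_; lookup)
open import Data.List using (List; []; _∷_; foldl; _∷ʳ_)
open import Data.Maybe using (Maybe; just; nothing; _>>=_)
open import Data.Product using (Σ; _×_; _,_; ∃)
open import Data.Sum using (_⊎_)
open import Data.Empty using (⊥)
open import Data.Unit using (⊤)
open import Data.Bool using (Bool; true; false; if_then_else_)
open import Relation.Nullary using (¬_; yes; no)
open import Relation.Binary.PropositionalEquality using (_≡_; _≢_)

Countable : Set → Set
Countable A = Σ (A → ℕ) λ e → ∀ a b → e a ≡ e b → a ≡ b

record Signature : Set₁ where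
  field
    Const Fun Rel : Set
    funAr : Fun → ℕ
    relAr : Rel → ℕ
    funAr-pos : ∀ f → 1 ≤ funAr f
    relAr-pos : ∀ R → 1 ≤ relAr R
    Const-countable : Countable Const
    Fun-countable : Countable Fun
    Rel-countable : Countable Rel

module Syntax (S : Signature) where
  open Signature S public

  -- Variable index k : ℕ stands for the variable v_(k+1).
  Var : Set
  Var = ℕ

  data Term : Set where
    var : Var → Term
    con : Const → Term
    app : (f : Fun) → Vec Term (funAr f) → Term

  infix 7 _≈ᶠ_
  infixl 5 _∧ᶠ_
  infixl 4 _∨ᶠ_

  data Formula : Set where
    ⊥ᶠ ⊤ᶠ : Formula
    _≈ᶠ_ : Term → Term → Formula
    rel : (R : Rel) → Vec Term (relAr R) → Formula
    ¬ᶠ_ : Formula → Formula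
    _∧ᶠ_ _∨ᶠ_ : Formula → Formula → Formula
    ∀ᶠ ∃ᶠ : Var → Formula → Formula

  mutual
    OccT : Var → Term → Set
    OccT x (var y) = x ≡ y
    OccT x (con c) = ⊥
    OccT x (app f ts) = OccTs x ts

    OccTs : ∀ {n} → Var → Vec Term n → Set
    OccTs x [] = ⊥
    OccTs x (t ∷ ts) = OccT x t ⊎ OccTs x ts

  Free : Var → Formula → Set
  Free x ⊥ᶠ = ⊥
  Free x ⊤ᶠ = ⊥
  Free x (s ≈ᶠ t) = OccT x s ⊎ OccT x t
  Free x (rel R ts) = OccTs x ts
  Free x (¬ᶠ φ) = Free x φ
  Free x (φ ∧ᶠ ψ) = Free x φ ⊎ Free x ψ
  Free x (φ ∨ᶠ ψ) = Free x φ ⊎ Free x ψ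
  Free x (∀ᶠ y φ) = x ≢ y × Free x φ
  Free x (∃ᶠ y φ) = x ≢ y × Free x φ

  Occ : Var → Formula → Set
  Occ x ⊥ᶠ = ⊥
  Occ x ⊤ᶠ = ⊥
  Occ x (s ≈ᶠ t) = OccT x s ⊎ OccT x t
  Occ x (rel R ts) = OccTs x ts
  Occ x (¬ᶠ φ) = Occ x φ
  Occ x (φ ∧ᶠ ψ) = Occ x φ ⊎ Occ x ψ
  Occ x (φ ∨ᶠ ψ) = Occ x φ ⊎ Occ x ψ
  Occ x (∀ᶠ y φ) = x ≡ y ⊎ Occ x φ
  Occ x (∃ᶠ y φ) = x ≡ y ⊎ Occ x φ

  mutual
    FOccT : Fun → Term → Set
    FOccT g (var y) = ⊥
    FOccT g (con c) = ⊥
    FOccT g (app f ts) = g ≡ f ⊎ FOccTs g ts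

    FOccTs : ∀ {n} → Fun → Vec Term n → Set
    FOccTs g [] = ⊥
    FOccTs g (t ∷ ts) = FOccT g t ⊎ FOccTs g ts

  FOcc : Fun → Formula → Set
  FOcc g ⊥ᶠ = ⊥
  FOcc g ⊤ᶠ = ⊥
  FOcc g (s ≈ᶠ t) = FOccT g s ⊎ FOccT g t
  FOcc g (rel R ts) = FOccTs g ts
  FOcc g (¬ᶠ φ) = FOcc g φ
  FOcc g (φ ∧ᶠ ψ) = FOcc g φ ⊎ FOcc g ψ
  FOcc g (φ ∨ᶠ ψ) = FOcc g φ ⊎ FOcc g ψ
  FOcc g (∀ᶠ y φ) = FOcc g φ
  FOcc g (∃ᶠ y φ) = FOcc g φ

  FreeFor : Term → Var → Formula → Set
  FreeFor t x ⊥ᶠ = ⊤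
  FreeFor t x ⊤ᶠ = ⊤
  FreeFor t x (s ≈ᶠ u) = ⊤
  FreeFor t x (rel R ts) = ⊤
  FreeFor t x (¬ᶠ φ) = FreeFor t x φ
  FreeFor t x (φ ∧ᶠ ψ) = FreeFor t x φ × FreeFor t x ψ
  FreeFor t x (φ ∨ᶠ ψ) = FreeFor t x φ × FreeFor t x ψ
  FreeFor t x (∀ᶠ y φ) = ¬ Free x (∀ᶠ y φ) ⊎ (¬ OccT y t × FreeFor t x φ)
  FreeFor t x (∃ᶠ y φ) = ¬ Free x (∃ᶠ y φ) ⊎ (¬ OccT y t × FreeFor t x φ)

  Subst : Set
  Subst = Var → Term

  _[_↦_] : Subst → Var → Term → Subst
  (s [ x ↦ t ]) y = if y ≡ᵇ x then t else s y

  mutual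
    substT : Subst → Term → Term
    substT s (var x) = s x
    substT s (con c) = con c
    substT s (app f ts) = app f (substTs s ts)

    substTs : ∀ {n} → Subst → Vec Term n → Vec Term n
    substTs s [] = []
    substTs s (t ∷ ts) = substT s t ∷ substTs s ts

  psub : Subst → Formula → Formula
  psub s ⊥ᶠ = ⊥ᶠ
  psub s ⊤ᶠ = ⊤ᶠ
  psub s (t ≈ᶠ u) = substT s t ≈ᶠ substT s u
  psub s (rel R ts) = rel R (substTs s ts)
  psub s (¬ᶠ φ) = ¬ᶠ psub s φ
  psub s (φ ∧ᶠ ψ) = psub s φ ∧ᶠ psub s ψ
  psub s (φ ∨ᶠ ψ) = psub s φ ∨ᶠ psub s ψ
  psub s (∀ᶠ x φ) = ∀ᶠ x (psub (s [ x ↦ var x ]) φ)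
  psub s (∃ᶠ x φ) = ∃ᶠ x (psub (s [ x ↦ var x ]) φ)

  _⟨_≔_⟩ : Formula → Var → Term → Formula
  φ ⟨ x ≔ t ⟩ = psub (var [ x ↦ t ]) φ

  assoc : ∀ {n} → Vec Var n → Vec Term n → Subst
  assoc [] [] y = var y
  assoc (x ∷ xs) (t ∷ ts) y = if y ≡ᵇ x then t else assoc xs ts y

  Distinct : ∀ {n} → Vec Var n → Set
  Distinct {n} xs = ∀ (i j : Fin n) → lookup xs i ≡ lookup xs j → i ≡ j

  mutual
    mvT : Term → ℕ
    mvT (var x) = x
    mvT (con c) = 0
    mvT (app f ts) = mvTs ts

    mvTs : ∀ {n} → Vec Term n → ℕ
    mvTs [] = 0
    mvTs (t ∷ ts) = mvT t ⊔ mvTs ts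

  mvF : Formula → ℕ
  mvF ⊥ᶠ = 0
  mvF ⊤ᶠ = 0
  mvF (t ≈ᶠ u) = mvT t ⊔ mvT u
  mvF (rel R ts) = mvTs ts
  mvF (¬ᶠ φ) = mvF φ
  mvF (φ ∧ᶠ ψ) = mvF φ ⊔ mvF ψ
  mvF (φ ∨ᶠ ψ) = mvF φ ⊔ mvF ψ
  mvF (∀ᶠ x φ) = x ⊔ mvF φ
  mvF (∃ᶠ x φ) = x ⊔ mvF φ

  -- capture-avoiding substitution: every bound variable is renamed to a
  -- fresh variable m, m+1, ... (m must exceed all variables of the
  -- substituted terms)
  csub : ℕ → Subst → Formula → Formula
  csub m s ⊥ᶠ = ⊥ᶠ
  csub m s ⊤ᶠ = ⊤ᶠ
  csub m s (t ≈ᶠ u) = substT s t ≈ᶠ substT s u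
  csub m s (rel R ts) = rel R (substTs s ts)
  csub m s (¬ᶠ φ) = ¬ᶠ csub m s φ
  csub m s (φ ∧ᶠ ψ) = csub m s φ ∧ᶠ csub m s ψ
  csub m s (φ ∨ᶠ ψ) = csub m s φ ∨ᶠ csub m s ψ
  csub m s (∀ᶠ x φ) = ∀ᶠ m (csub (suc m) (s [ x ↦ var m ]) φ)
  csub m s (∃ᶠ x φ) = ∃ᶠ m (csub (suc m) (s [ x ↦ var m ]) φ)

  vecEnv : ∀ {n} → Vec Term n → Subst
  vecEnv {n} ts k with k <? n
  ... | yes k<n = lookup ts (fromℕ< k<n)
  ... | no _ = var k

  record IsDefFormulas : Set where
    field
      δ : Fun → Formula
      δ-free : ∀ f x → Free x (δ f) → x < funAr f
      δ-nested : ∀ f g → FOcc g (δ f) → δ g ≡ ⊤ᶠ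

  data TV : Set where
    𝐅 𝐔 𝐓 : TV

  data _≤ᵗ_ : TV → TV → Set where
    F≤ : ∀ {a} → 𝐅 ≤ᵗ a
    U≤U : 𝐔 ≤ᵗ 𝐔
    U≤T : 𝐔 ≤ᵗ 𝐓
    T≤T : 𝐓 ≤ᵗ 𝐓

  negᵗ : TV → TV
  negᵗ 𝐅 = 𝐓
  negᵗ 𝐔 = 𝐔
  negᵗ 𝐓 = 𝐅

  minᵗ : TV → TV → TV
  minᵗ 𝐅 b = 𝐅
  minᵗ 𝐔 𝐅 = 𝐅
  minᵗ 𝐔 b = 𝐔
  minᵗ 𝐓 b = b

  maxᵗ : TV → TV → TV
  maxᵗ 𝐅 b = b
  maxᵗ 𝐔 𝐓 = 𝐓
  maxᵗ 𝐔 b = 𝐔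
  maxᵗ 𝐓 b = 𝐓

  IsMin IsMax : {D : Set} → (D → TV) → TV → Set
  IsMin {D} w a = (∀ d → a ≤ᵗ w d) × Σ D (λ d → w d ≡ a)
  IsMax {D} w a = (∀ d → w d ≤ᵗ a) × Σ D (λ d → w d ≡ a)

  record Structure : Set₁ where
    field
      D : Set
      d₀ : D
      conI : Const → D
      funI : (f : Fun) → Vec D (funAr f) → Maybe D
      relI : (R : Rel) → Vec D (relAr R) → Set

  module Sem (σ : Structure) where
    open Structure σ

    Assignment : Set
    Assignment = Var → D

    _[_≔_]ᵃ : Assignment → Var → D → Assignment
    (ν [ x ≔ d ]ᵃ) y = if y ≡ᵇ x then d else ν y

    mutual
      evalT : Assignment → Term → Maybe D
      evalT ν (var x) = just (ν x)
      evalT ν (con c) = just (conI c)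
      evalT ν (app f ts) = evalTs ν ts >>= funI f

      evalTs : ∀ {n} → Assignment → Vec Term n → Maybe (Vec D n)
      evalTs ν [] = just []
      evalTs ν (t ∷ ts) = evalT ν t >>= λ d → evalTs ν ts >>= λ ds → just (d ∷ ds)

    data Val (ν : Assignment) : Formula → TV → Set where
      v-F : Val ν ⊥ᶠ 𝐅
      v-T : Val ν ⊤ᶠ 𝐓
      v-eq-U : ∀ {s t} → evalT ν s ≡ nothing ⊎ evalT ν t ≡ nothing → Val ν (s ≈ᶠ t) 𝐔
      v-eq-T : ∀ {s t d e} → evalT ν s ≡ just d → evalT ν t ≡ just e → d ≡ e → Val ν (s ≈ᶠ t) 𝐓
      v-eq-F : ∀ {s t d e} → evalT ν s ≡ just d → evalT ν t ≡ just e → d ≢ e → Val ν (s ≈ᶠ t) 𝐅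
      v-rel-U : ∀ {R ts} → evalTs ν ts ≡ nothing → Val ν (rel R ts) 𝐔
      v-rel-T : ∀ {R ts ds} → evalTs ν ts ≡ just ds → relI R ds → Val ν (rel R ts) 𝐓
      v-rel-F : ∀ {R ts ds} → evalTs ν ts ≡ just ds → ¬ relI R ds → Val ν (rel R ts) 𝐅
      v-¬ : ∀ {φ a} → Val ν φ a → Val ν (¬ᶠ φ) (negᵗ a)
      v-∧ : ∀ {φ ψ a b} → Val ν φ a → Val ν ψ b → Val ν (φ ∧ᶠ ψ) (minᵗ a b)
      v-∨ : ∀ {φ ψ a b} → Val ν φ a → Val ν ψ b → Val ν (φ ∨ᶠ ψ) (maxᵗ a b)
      v-∀ : ∀ {x φ a} (w : D → TV) → (∀ d → Val (ν [ x ≔ d ]ᵃ) φ (w d)) → IsMin w a → Val ν (∀ᶠ x φ) a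
      v-∃ : ∀ {x φ a} (w : D → TV) → (∀ d → Val (ν [ x ≔ d ]ᵃ) φ (w d)) → IsMax w a → Val ν (∃ᶠ x φ) a

module Logic (S : Signature) (Δ : Syntax.IsDefFormulas S) where
  open Syntax S
  open IsDefFormulas Δ

  instδ : (f : Fun) → Vec Term (funAr f) → Formula
  instδ f ts = csub (suc (mvTs ts ⊔ mvF (δ f))) (vecEnv ts) (δ f)

  -- left-associated conjunction of a (nonempty) list
  conj : List Formula → Formula
  conj [] = ⊤ᶠ
  conj (φ ∷ φs) = foldl _∧ᶠ_ φ φs

  mutual
    DefT : Term → Formula
    DefT (var x) = ⊤ᶠ
    DefT (con c) = ⊤ᶠ
    DefT (app f ts) = conj (DefTs ts ∷ʳ instδ f ts)

    DefTs : ∀ {n} → Vec Term n → List Formula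
    DefTs [] = []
    DefTs (t ∷ ts) = DefT t ∷ DefTs ts

  Def : Formula → Formula
  Def ⊥ᶠ = ⊤ᶠ
  Def ⊤ᶠ = ⊤ᶠ
  Def (t ≈ᶠ u) = DefT t ∧ᶠ DefT u
  Def (rel R ts) = conj (DefTs ts)
  Def (¬ᶠ φ) = Def φ
  Def (φ ∧ᶠ ψ) = (Def φ ∧ᶠ Def ψ) ∨ᶠ (Def φ ∧ᶠ ¬ᶠ φ) ∨ᶠ (Def ψ ∧ᶠ ¬ᶠ ψ)
  Def (φ ∨ᶠ ψ) = (Def φ ∧ᶠ Def ψ) ∨ᶠ (Def φ ∧ᶠ φ) ∨ᶠ (Def ψ ∧ᶠ ψ)
  Def (∀ᶠ x φ) = ∀ᶠ x (Def φ) ∨ᶠ ∃ᶠ x (Def φ ∧ᶠ ¬ᶠ φ)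
  Def (∃ᶠ x φ) = ∀ᶠ x (Def φ) ∨ᶠ ∃ᶠ x (Def φ ∧ᶠ φ)

  FSet : Set₁
  FSet = Formula → Set

  ∅ : FSet
  ∅ _ = ⊥

  ｛_｝ : Formula → FSet
  ｛ φ ｝ χ = χ ≡ φ

  ｛_⨾_｝ : Formula → Formula → FSet
  ｛ φ ⨾ ψ ｝ χ = χ ≡ φ ⊎ χ ≡ ψ

  _∪_ : FSet → FSet → FSet
  (Γ ∪ Γ') χ = Γ χ ⊎ Γ' χ

  _≐_ : FSet → FSet → Set
  Γ ≐ Γ' = (∀ χ → Γ χ → Γ' χ) × (∀ χ → Γ' χ → Γ χ)

  infix 2 _⊢_ _⊨_
  infixl 6 _∪_

  data _⊢_ : FSet → Formula → Set₁ where
    -- provability is a relation between *sets*: respect set equality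
    set-ext : ∀ {Γ Γ' φ} → Γ ≐ Γ' → Γ ⊢ φ → Γ' ⊢ φ
    P1 : ∀ {φ} → ｛ φ ｝ ⊢ φ
    P2 : ∀ {Γ Γ' φ} → Γ ⊢ φ → Γ ∪ Γ' ⊢ φ
    P3 : ∀ {Γ φ ψ} → Γ ⊢ φ → Γ ∪ ｛ φ ｝ ⊢ ψ → Γ ⊢ ψ
    C1 : ∀ {φ} → ∅ ⊢ (φ ∨ᶠ ¬ᶠ φ) ∨ᶠ ¬ᶠ Def φ
    C2 : ∀ {φ} → ｛ ⊥ᶠ ｝ ⊢ φ
    C3 : ∀ {φ} → ｛ φ ⨾ ¬ᶠ φ ｝ ⊢ ⊥ᶠ
    D1 : ∀ {φ} → ｛ φ ｝ ⊢ Def φ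
    ∧-I : ∀ {φ ψ} → ｛ φ ⨾ ψ ｝ ⊢ φ ∧ᶠ ψ
    ∧-E1 : ∀ {φ ψ} → ｛ φ ∧ᶠ ψ ｝ ⊢ φ
    ∧-E2 : ∀ {φ ψ} → ｛ φ ∧ᶠ ψ ｝ ⊢ ψ
    ∨-I1 : ∀ {φ ψ} → ｛ φ ｝ ⊢ φ ∨ᶠ ψ
    ∨-I2 : ∀ {φ ψ} → ｛ ψ ｝ ⊢ φ ∨ᶠ ψ
    ∨-E : ∀ {Γ φ ψ χ} → Γ ∪ ｛ φ ｝ ⊢ χ → Γ ∪ ｛ ψ ｝ ⊢ χ → Γ ∪ ｛ φ ∨ᶠ ψ ｝ ⊢ χ
    =-1 : ∀ {t} → ｛ DefT t ｝ ⊢ t ≈ᶠ t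
    =-2 : ∀ {n} (φ : Formula) (xs : Vec Var n) → Distinct xs →
          (ts : Vec Term n) (i : Fin n) (t' : Term) →
          (∀ j → FreeFor (lookup ts j) (lookup xs j) φ) → FreeFor t' (lookup xs i) φ →
          ｛ lookup ts i ≈ᶠ t' ⨾ psub (assoc xs ts) φ ｝ ⊢ psub (assoc xs (ts Data.Vec.[ i ]≔ t')) φ
    ∀-E : ∀ {t x φ} → FreeFor t x φ → ｛ DefT t ⨾ ∀ᶠ x φ ｝ ⊢ φ ⟨ x ≔ t ⟩
    ∀-I : ∀ {Γ x φ} → Γ ⊢ φ → (∀ χ → Γ χ → ¬ Free x χ) → Γ ⊢ ∀ᶠ x φ
    ∃-I : ∀ {t x φ} → FreeFor t x φ → ｛ φ ⟨ x ≔ t ⟩ ｝ ⊢ ∃ᶠ x φ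
    ∃-E : ∀ {Γ x y φ ψ} → Γ ∪ ｛ φ ⟨ x ≔ var y ⟩ ｝ ⊢ ψ →
          (∀ χ → Γ χ → ¬ Occ y χ) → ¬ Occ y (∃ᶠ x φ) → ¬ Occ y ψ →
          Γ ∪ ｛ ∃ᶠ x φ ｝ ⊢ ψ

  Satδ : Structure → Set
  Satδ σ = ∀ (f : Fun) (ds : Vec D (funAr f)) (ν : Assignment) →
           (∀ i → ν (toℕ i) ≡ lookup ds i) →
           (Val ν (δ f) 𝐓 → Σ D (λ d → funI f ds ≡ just d)) ×
           (Σ D (λ d → funI f ds ≡ just d) → Val ν (δ f) 𝐓)
    where open Structure σ
          open Sem σ

  IsModel : FSet → (σ : Structure) → (Var → Structure.D σ) → Set
  IsModel Γ σ ν = Satδ σ × (∀ χ → Γ χ → Sem.Val σ ν χ 𝐓)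

  HasModel : FSet → Set₁
  HasModel Γ = Σ Structure λ σ → Σ (Var → Structure.D σ) λ ν → IsModel Γ σ ν

  _⊨_ : FSet → Formula → Set₁
  Γ ⊨ φ = ∀ (σ : Structure) (ν : Var → Structure.D σ) → IsModel Γ σ ν → Sem.Val σ ν φ 𝐓

module Submission where

{-
Three-valued analytic tableaux. A signed formula "φ has value v" is expressed in the calculus by
φ, ¬ φ or ¬ Def φ, and every rule of a tableau whose items are signed formulas, paired with an
assignment of parameters to their free variables, is derivable for all formulas that instantiate
the item up to the choice of bound variables. Rules are analytic, so two such instances of one
formula never have to be compared and no provability of α-equivalence is needed. Derivations use
finitely many premises, so a fresh variable is always available, although Γ itself may contain all
variables. The refutation calculus is a small inductive type, which is what makes excluded middle
at level zero applicable; an irrefutable set is extended to a saturated one along an enumeration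
of all items. Every sign occurring in the saturated set is the truth value in the structure whose
elements are parameters modulo provable equality. The second part follows by refuting the signs
F and U for φ.
-}

open import Defs
open import Level using (0ℓ)
open import Axiom.ExcludedMiddle using (ExcludedMiddle)
open import Data.Bool using (true; false; if_then_else_)
open import Data.Empty using (⊥-elim)
open import Data.Fin using (Fin; zero; suc; toℕ; fromℕ<)
open import Data.Fin.Properties using (toℕ-fromℕ<)
open import Data.List using (List; []; _∷_; _++_; foldl; map; filter; cartesianProduct; allFin)
open import Data.List.Membership.Propositional using (_∈_; find; lose)
open import Data.List.Membership.Propositional.Properties
  using (∈-++⁺ˡ; ∈-++⁺ʳ; ∈-++⁻; ∈-map⁺; ∈-map⁻; ∈-filter⁺; ∈-filter⁻; ∈-cartesianProduct⁺; ∈-allFin)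
open import Data.List.Relation.Binary.Subset.Propositional using (_⊆_)
open import Data.List.Relation.Unary.All as All using (All; []; _∷_)
import Data.List.Relation.Unary.All.Properties as All
open import Data.List.Relation.Unary.Any as Any using (Any; here; there)
open import Data.Maybe using (Maybe; just; nothing; _>>=_)
open import Data.Maybe.Properties using (just-injective)
open import Data.Nat using (ℕ; zero; suc; _+_; _⊔_; _≤_; _<_; _≡ᵇ_; _<?_; _≟_; ⌊_/2⌋; z≤n; s≤s)
open import Data.Nat.Properties
open import Data.Product using (Σ; _×_; _,_; proj₁; proj₂)
open import Data.Sum using (_⊎_; inj₁; inj₂; [_,_])
open import Data.Unit using (tt)
open import Data.Vec as Vec using (Vec; []; _∷_; lookup)
open import Data.Vec.Properties using (lookup-map)
open import Function using (_∘_; id; case_of_)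
open import Relation.Binary.PropositionalEquality using (_≡_; _≢_; refl; sym; trans; cong; cong₂; subst)
open import Relation.Nullary using (Dec; ¬_; yes; no)

-- The obstacle is the syntax of `Def`. The formula `instδ f ts` takes its bound names from `ts`, so
-- `Def (φ ⟨ x ≔ t ⟩)` and `(Def φ) ⟨ x ≔ t ⟩` are in general different formulas, and no rule
-- identifies variants. The sign U therefore cannot be moved through a quantifier by instantiating
-- `Def φ`. The way round is decidedness: by `C1` and `D1` the formulas `∀ᶠ x (Def φ)` and
-- `∀ᶠ x (φ ∨ᶠ ¬ᶠ φ)` are interderivable, and `φ ∨ᶠ ¬ᶠ φ` commutes with substitution on the nose.
-- The same two rules carry the signs: `C1` makes them exhaustive, and `D1` makes them exclusive,
-- because `Def (¬ᶠ φ)` is literally `Def φ`. Provability itself lives in `Set₁`, since its contexts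
-- are arbitrary predicates; this is why consistency is decided for refutations and not for
-- derivations.

if-≡ : ∀ {A : Set} {x y} {a b : A} → y ≡ x → (if y ≡ᵇ x then a else b) ≡ a
if-≡ {x = x} {y} y≡x with y ≡ᵇ x in eq
... | true = refl
... | false = ⊥-elim (subst Data.Bool.T eq (≡⇒≡ᵇ y x y≡x))

if-≢ : ∀ {A : Set} {x y} {a b : A} → y ≢ x → (if y ≡ᵇ x then a else b) ≡ b
if-≢ {x = x} {y} y≢x with y ≡ᵇ x in eq
... | true = ⊥-elim (y≢x (≡ᵇ⇒≡ y x (subst Data.Bool.T (sym eq) tt)))
... | false = refl

odd≢even : ∀ m n → suc (m + m) ≢ n + n
odd≢even zero (suc n) eq = case trans (suc-injective eq) (+-suc n n) of λ ()
odd≢even (suc m) (suc n) eq = odd≢even m n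
  (suc-injective (trans (cong suc (sym (+-suc m m))) (trans (suc-injective eq) (+-suc n n))))

-- Freshness, substitution, and renaming a free variable there and back.

module SyntaxLemmas (S : Signature) where
  open Syntax S

  mutual
    occ≤mvT : ∀ {x} t → OccT x t → x ≤ mvT t
    occ≤mvT (var y) refl = ≤-refl
    occ≤mvT (app f ts) o = occ≤mvTs ts o

    occ≤mvTs : ∀ {n x} (ts : Vec Term n) → OccTs x ts → x ≤ mvTs ts
    occ≤mvTs (t ∷ ts) (inj₁ o) = ≤-trans (occ≤mvT t o) (m≤m⊔n _ _)
    occ≤mvTs (t ∷ ts) (inj₂ o) = ≤-trans (occ≤mvTs ts o) (m≤n⊔m (mvT t) _)

  private
    left : ∀ {x m n} → x ≤ m → x ≤ m ⊔ n
    left p = ≤-trans p (m≤m⊔n _ _)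
    right : ∀ {x m n} → x ≤ n → x ≤ m ⊔ n
    right {m = m} p = ≤-trans p (m≤n⊔m m _)

  occ≤mvF : ∀ {x} φ → Occ x φ → x ≤ mvF φ
  occ≤mvF (s ≈ᶠ t) (inj₁ o) = left (occ≤mvT s o)
  occ≤mvF (s ≈ᶠ t) (inj₂ o) = right (occ≤mvT t o)
  occ≤mvF (rel R ts) o = occ≤mvTs ts o
  occ≤mvF (¬ᶠ φ) o = occ≤mvF φ o
  occ≤mvF (φ ∧ᶠ ψ) (inj₁ o) = left (occ≤mvF φ o)
  occ≤mvF (φ ∧ᶠ ψ) (inj₂ o) = right (occ≤mvF ψ o)
  occ≤mvF (φ ∨ᶠ ψ) (inj₁ o) = left (occ≤mvF φ o)
  occ≤mvF (φ ∨ᶠ ψ) (inj₂ o) = right (occ≤mvF ψ o)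
  occ≤mvF (∀ᶠ y φ) (inj₁ refl) = left ≤-refl
  occ≤mvF (∀ᶠ y φ) (inj₂ o) = right (occ≤mvF φ o)
  occ≤mvF (∃ᶠ y φ) (inj₁ refl) = left ≤-refl
  occ≤mvF (∃ᶠ y φ) (inj₂ o) = right (occ≤mvF φ o)

  free⇒occ : ∀ {x} φ → Free x φ → Occ x φ
  free⇒occ (s ≈ᶠ t) o = o
  free⇒occ (rel R ts) o = o
  free⇒occ (¬ᶠ φ) o = free⇒occ φ o
  free⇒occ (φ ∧ᶠ ψ) (inj₁ o) = inj₁ (free⇒occ φ o)
  free⇒occ (φ ∧ᶠ ψ) (inj₂ o) = inj₂ (free⇒occ ψ o)
  free⇒occ (φ ∨ᶠ ψ) (inj₁ o) = inj₁ (free⇒occ φ o)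
  free⇒occ (φ ∨ᶠ ψ) (inj₂ o) = inj₂ (free⇒occ ψ o)
  free⇒occ (∀ᶠ y φ) (_ , o) = inj₂ (free⇒occ φ o)
  free⇒occ (∃ᶠ y φ) (_ , o) = inj₂ (free⇒occ φ o)

  fresh-occ : ∀ {z} φ → mvF φ < z → ¬ Occ z φ
  fresh-occ φ φ<z o = <⇒≱ φ<z (occ≤mvF φ o)

  fresh-free : ∀ {z} φ → mvF φ < z → ¬ Free z φ
  fresh-free φ φ<z o = fresh-occ φ φ<z (free⇒occ φ o)

  fresh-occT : ∀ {z} t → mvT t < z → ¬ OccT z t
  fresh-occT t t<z o = <⇒≱ t<z (occ≤mvT t o)

  mutual
    substT-cong : ∀ {s s'} t → (∀ x → OccT x t → s x ≡ s' x) → substT s t ≡ substT s' t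
    substT-cong (var x) h = h x refl
    substT-cong (con c) h = refl
    substT-cong (app f ts) h = cong (app f) (substTs-cong ts h)

    substTs-cong : ∀ {n s s'} (ts : Vec Term n) → (∀ x → OccTs x ts → s x ≡ s' x) →
      substTs s ts ≡ substTs s' ts
    substTs-cong [] h = refl
    substTs-cong (t ∷ ts) h =
      cong₂ _∷_ (substT-cong t λ x → h x ∘ inj₁) (substTs-cong ts λ x → h x ∘ inj₂)

  mutual
    substT-var : ∀ t → substT var t ≡ t
    substT-var (var x) = refl
    substT-var (con c) = refl
    substT-var (app f ts) = cong (app f) (substTs-var ts)

    substTs-var : ∀ {n} (ts : Vec Term n) → substTs var ts ≡ ts
    substTs-var [] = refl
    substTs-var (t ∷ ts) = cong₂ _∷_ (substT-var t) (substTs-var ts)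

  mutual
    substT-∘ : ∀ {s s'} t → substT s' (substT s t) ≡ substT (substT s' ∘ s) t
    substT-∘ (var x) = refl
    substT-∘ (con c) = refl
    substT-∘ (app f ts) = cong (app f) (substTs-∘ ts)

    substTs-∘ : ∀ {n s s'} (ts : Vec Term n) → substTs s' (substTs s ts) ≡ substTs (substT s' ∘ s) ts
    substTs-∘ [] = refl
    substTs-∘ (t ∷ ts) = cong₂ _∷_ (substT-∘ t) (substTs-∘ ts)

  substT-id : ∀ {s} t → (∀ x → OccT x t → s x ≡ var x) → substT s t ≡ t
  substT-id t h = trans (substT-cong t h) (substT-var t)

  substTs-id : ∀ {n s} (ts : Vec Term n) → (∀ x → OccTs x ts → s x ≡ var x) → substTs s ts ≡ ts
  substTs-id ts h = trans (substTs-cong ts h) (substTs-var ts)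

  substT-fresh : ∀ {x u} t → mvT t < x → substT (var [ x ↦ u ]) t ≡ t
  substT-fresh {x} t t<x = substT-id t λ y o → if-≢ {x = x} {y} λ { refl → fresh-occT t t<x o }

  substTs-fresh : ∀ {n x u} (ts : Vec Term n) → mvTs ts < x → substTs (var [ x ↦ u ]) ts ≡ ts
  substTs-fresh {x = x} ts ts<x = substTs-id ts λ y o → if-≢ {x = x} {y} λ { refl → <⇒≱ ts<x (occ≤mvTs ts o) }

  psub-id : ∀ {s} φ → (∀ x → s x ≡ var x) → psub s φ ≡ φ
  psub-id-binder : ∀ {s} x φ → (∀ y → s y ≡ var y) → psub (s [ x ↦ var x ]) φ ≡ φ
  psub-id ⊥ᶠ h = refl
  psub-id ⊤ᶠ h = refl
  psub-id (s ≈ᶠ t) h = cong₂ _≈ᶠ_ (substT-id s λ x _ → h x) (substT-id t λ x _ → h x)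
  psub-id (rel R ts) h = cong (rel R) (substTs-id ts λ x _ → h x)
  psub-id (¬ᶠ φ) h = cong ¬ᶠ_ (psub-id φ h)
  psub-id (φ ∧ᶠ ψ) h = cong₂ _∧ᶠ_ (psub-id φ h) (psub-id ψ h)
  psub-id (φ ∨ᶠ ψ) h = cong₂ _∨ᶠ_ (psub-id φ h) (psub-id ψ h)
  psub-id (∀ᶠ x φ) h = cong (∀ᶠ x) (psub-id-binder x φ h)
  psub-id (∃ᶠ x φ) h = cong (∃ᶠ x) (psub-id-binder x φ h)
  psub-id-binder x φ h = psub-id φ λ y → case y ≟ x of λ where
    (yes refl) → if-≡ {x = y} refl
    (no y≢x) → trans (if-≢ y≢x) (h y)

  psub-self : ∀ x φ → φ ⟨ x ≔ var x ⟩ ≡ φ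
  psub-self x φ = psub-id-binder x φ λ _ → refl

  freeFor-self : ∀ x φ → FreeFor (var x) x φ
  freeFor-self-binder : ∀ x y φ → ¬ (x ≢ y × Free x φ) ⊎ (¬ OccT y (var x) × FreeFor (var x) x φ)
  freeFor-self x ⊥ᶠ = tt
  freeFor-self x ⊤ᶠ = tt
  freeFor-self x (_ ≈ᶠ _) = tt
  freeFor-self x (rel R ts) = tt
  freeFor-self x (¬ᶠ φ) = freeFor-self x φ
  freeFor-self x (φ ∧ᶠ ψ) = freeFor-self x φ , freeFor-self x ψ
  freeFor-self x (φ ∨ᶠ ψ) = freeFor-self x φ , freeFor-self x ψ
  freeFor-self x (∀ᶠ y φ) = freeFor-self-binder x y φ
  freeFor-self x (∃ᶠ y φ) = freeFor-self-binder x y φ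
  freeFor-self-binder x y φ with x ≟ y
  ... | yes refl = inj₁ λ (x≢x , _) → x≢x refl
  ... | no x≢y = inj₂ ((λ { refl → x≢y refl }) , freeFor-self x φ)

  freeFor-fresh : ∀ {z} x φ → ¬ Occ z φ → FreeFor (var z) x φ
  freeFor-fresh x ⊥ᶠ z∉ = tt
  freeFor-fresh x ⊤ᶠ z∉ = tt
  freeFor-fresh x (_ ≈ᶠ _) z∉ = tt
  freeFor-fresh x (rel R ts) z∉ = tt
  freeFor-fresh x (¬ᶠ φ) z∉ = freeFor-fresh x φ z∉
  freeFor-fresh x (φ ∧ᶠ ψ) z∉ = freeFor-fresh x φ (z∉ ∘ inj₁) , freeFor-fresh x ψ (z∉ ∘ inj₂)
  freeFor-fresh x (φ ∨ᶠ ψ) z∉ = freeFor-fresh x φ (z∉ ∘ inj₁) , freeFor-fresh x ψ (z∉ ∘ inj₂)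
  freeFor-fresh x (∀ᶠ y φ) z∉ = inj₂ ((λ { refl → z∉ (inj₁ refl) }) , freeFor-fresh x φ (z∉ ∘ inj₂))
  freeFor-fresh x (∃ᶠ y φ) z∉ = inj₂ ((λ { refl → z∉ (inj₁ refl) }) , freeFor-fresh x φ (z∉ ∘ inj₂))

  -- A pair of substitutions undoing each other on every variable other than z, which the
  -- first one may use as a new name; unlike φ ⟨ y ≔ var z ⟩ itself this is stable under binders.
  RoundTrip : Var → Subst → Subst → Set
  RoundTrip z s s' = ∀ w → w ≢ z → (s w ≡ var w × s' w ≡ var w) ⊎ (s w ≡ var z × s' z ≡ var w)

  roundTrip-binder : ∀ {z s s'} x → x ≢ z → RoundTrip z s s' →
    RoundTrip z (s [ x ↦ var x ]) (s' [ x ↦ var x ])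
  roundTrip-binder {z} {s} {s'} x x≢z h w w≢z with w ≟ x
  ... | yes refl = inj₁ (if-≡ {x = w} refl , if-≡ {x = w} refl)
  ... | no w≢x with h w w≢z
  ...   | inj₁ (p , q) = inj₁ (trans (if-≢ w≢x) p , trans (if-≢ w≢x) q)
  ...   | inj₂ (p , q) = inj₂ (trans (if-≢ w≢x) p , trans (if-≢ (x≢z ∘ sym)) q)

  roundTrip-var : ∀ {z s s'} → RoundTrip z s s' → ∀ w → w ≢ z → substT s' (s w) ≡ var w
  roundTrip-var {s' = s'} h w w≢z with h w w≢z
  ... | inj₁ (p , q) = trans (cong (substT s') p) q
  ... | inj₂ (p , q) = trans (cong (substT s') p) q

  -- A binder resets both substitutions to the identity on its variable, which again gives a round
  -- trip; since `z` does not occur, no binder can capture it.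
  psub-roundTrip : ∀ {z s s'} φ → ¬ Occ z φ → RoundTrip z s s' → psub s' (psub s φ) ≡ φ
  psub-roundTrip ⊥ᶠ z∉ h = refl
  psub-roundTrip ⊤ᶠ z∉ h = refl
  psub-roundTrip (s ≈ᶠ t) z∉ h = cong₂ _≈ᶠ_
    (trans (substT-∘ s) (substT-id s λ w o → roundTrip-var h w λ { refl → z∉ (inj₁ o) }))
    (trans (substT-∘ t) (substT-id t λ w o → roundTrip-var h w λ { refl → z∉ (inj₂ o) }))
  psub-roundTrip (rel R ts) z∉ h = cong (rel R)
    (trans (substTs-∘ ts) (substTs-id ts λ w o → roundTrip-var h w λ { refl → z∉ o }))
  psub-roundTrip (¬ᶠ φ) z∉ h = cong ¬ᶠ_ (psub-roundTrip φ z∉ h)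
  psub-roundTrip (φ ∧ᶠ ψ) z∉ h =
    cong₂ _∧ᶠ_ (psub-roundTrip φ (z∉ ∘ inj₁) h) (psub-roundTrip ψ (z∉ ∘ inj₂) h)
  psub-roundTrip (φ ∨ᶠ ψ) z∉ h =
    cong₂ _∨ᶠ_ (psub-roundTrip φ (z∉ ∘ inj₁) h) (psub-roundTrip ψ (z∉ ∘ inj₂) h)
  psub-roundTrip (∀ᶠ x φ) z∉ h =
    cong (∀ᶠ x) (psub-roundTrip φ (z∉ ∘ inj₂) (roundTrip-binder x (λ { refl → z∉ (inj₁ refl) }) h))
  psub-roundTrip (∃ᶠ x φ) z∉ h =
    cong (∃ᶠ x) (psub-roundTrip φ (z∉ ∘ inj₂) (roundTrip-binder x (λ { refl → z∉ (inj₁ refl) }) h))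

  roundTrip-↦ : ∀ y z → RoundTrip z (var [ y ↦ var z ]) (var [ z ↦ var y ])
  roundTrip-↦ y z w w≢z with w ≟ y
  ... | yes refl = inj₂ (if-≡ {x = w} refl , if-≡ {x = z} refl)
  ... | no w≢y = inj₁ (if-≢ w≢y , if-≢ w≢z)

  mutual
    occT-subst : ∀ {s x} t → OccT x (substT s t) → Σ Var λ w → OccT w t × OccT x (s w)
    occT-subst (var w) o = w , refl , o
    occT-subst (app f ts) o = occTs-subst ts o

    occTs-subst : ∀ {n s x} (ts : Vec Term n) → OccTs x (substTs s ts) →
      Σ Var λ w → OccTs w ts × OccT x (s w)
    occTs-subst (t ∷ ts) (inj₁ o) = let w , p , q = occT-subst t o in w , inj₁ p , q
    occTs-subst (t ∷ ts) (inj₂ o) = let w , p , q = occTs-subst ts o in w , inj₂ p , q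

  private
    free-binder : ∀ {x y s w} {A : Set} → x ≢ y → OccT x ((s [ y ↦ var y ]) w) → A →
      (w ≢ y × A) × OccT x (s w)
    free-binder {x} {y} {s} {w} x≢y o a with w ≟ y
    ... | yes refl = ⊥-elim (x≢y (subst (OccT x) (if-≡ {x = w} {b = s w} refl) o))
    ... | no w≢y = (w≢y , a) , subst (OccT x) (if-≢ w≢y) o

  free-psub : ∀ {s x} φ → Free x (psub s φ) → Σ Var λ w → Free w φ × OccT x (s w)
  free-psub (s ≈ᶠ t) (inj₁ o) = let w , p , q = occT-subst s o in w , inj₁ p , q
  free-psub (s ≈ᶠ t) (inj₂ o) = let w , p , q = occT-subst t o in w , inj₂ p , q
  free-psub (rel R ts) o = occTs-subst ts o
  free-psub (¬ᶠ φ) o = free-psub φ o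
  free-psub (φ ∧ᶠ ψ) (inj₁ o) = let w , p , q = free-psub φ o in w , inj₁ p , q
  free-psub (φ ∧ᶠ ψ) (inj₂ o) = let w , p , q = free-psub ψ o in w , inj₂ p , q
  free-psub (φ ∨ᶠ ψ) (inj₁ o) = let w , p , q = free-psub φ o in w , inj₁ p , q
  free-psub (φ ∨ᶠ ψ) (inj₂ o) = let w , p , q = free-psub ψ o in w , inj₂ p , q
  free-psub {s} (∀ᶠ y φ) (x≢y , o) = let w , p , q = free-psub φ o in w , free-binder {s = s} x≢y q p
  free-psub {s} (∃ᶠ y φ) (x≢y , o) = let w , p , q = free-psub φ o in w , free-binder {s = s} x≢y q p

  -- z is introduced only in place of y, hence never below a binder of y.
  freeFor-back : ∀ {y z s} φ → ¬ Occ z φ → (∀ w → w ≢ y → w ≢ z → ¬ OccT z (s w)) →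
    FreeFor (var y) z (psub s φ)
  freeFor-back-binder : ∀ {y z s} x φ → ¬ (z ≡ x ⊎ Occ z φ) →
    (∀ w → w ≢ y → w ≢ z → ¬ OccT z (s w)) →
    ¬ (z ≢ x × Free z (psub (s [ x ↦ var x ]) φ)) ⊎
    (¬ OccT x (var y) × FreeFor (var y) z (psub (s [ x ↦ var x ]) φ))
  freeFor-back ⊥ᶠ z∉ h = tt
  freeFor-back ⊤ᶠ z∉ h = tt
  freeFor-back (_ ≈ᶠ _) z∉ h = tt
  freeFor-back (rel R ts) z∉ h = tt
  freeFor-back (¬ᶠ φ) z∉ h = freeFor-back φ z∉ h
  freeFor-back (φ ∧ᶠ ψ) z∉ h = freeFor-back φ (z∉ ∘ inj₁) h , freeFor-back ψ (z∉ ∘ inj₂) h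
  freeFor-back (φ ∨ᶠ ψ) z∉ h = freeFor-back φ (z∉ ∘ inj₁) h , freeFor-back ψ (z∉ ∘ inj₂) h
  freeFor-back (∀ᶠ x φ) z∉ h = freeFor-back-binder x φ z∉ h
  freeFor-back (∃ᶠ x φ) z∉ h = freeFor-back-binder x φ z∉ h
  freeFor-back-binder {y} {z} {s} x φ z∉ h with x ≟ y
  ... | no x≢y = inj₂ (x≢y , freeFor-back φ (z∉ ∘ inj₂) λ w w≢y w≢z o →
    case w ≟ x of λ where
      (yes refl) → w≢z (sym (subst (OccT z) (if-≡ {x = w} {b = s w} refl) o))
      (no w≢x) → h w w≢y w≢z (subst (OccT z) (if-≢ w≢x) o))
  ... | yes refl = inj₁ λ (z≢x , o) →
    let w , p , q = free-psub φ o in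
    let (w≢x , _) , q' = free-binder {s = s} z≢x q tt in
    h w w≢x (λ w≡z → z∉ (inj₂ (subst (λ v → Occ v φ) w≡z (free⇒occ φ p)))) q'

  freeFor-rename : ∀ {z} y φ → ¬ Occ z φ → FreeFor (var y) z (φ ⟨ y ≔ var z ⟩)
  freeFor-rename {z} y φ z∉ = freeFor-back φ z∉ λ w w≢y w≢z o →
    w≢z (sym (subst (OccT z) (if-≢ w≢y) o))

  notFree-rename : ∀ {z} y φ → z ≢ y → ¬ Free y (φ ⟨ y ≔ var z ⟩)
  notFree-rename {z} y φ z≢y o with free-psub φ o
  ... | w , _ , q with w ≟ y
  ...   | yes refl = z≢y (sym (subst (OccT w) (if-≡ {x = w} {b = var w} refl) q))
  ...   | no w≢y = w≢y (sym (subst (OccT y) (if-≢ w≢y) q))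

-- Derived rules over finite contexts.

module DerivedRules (S : Signature) (Δ : Syntax.IsDefFormulas S) where
  open Syntax S
  open IsDefFormulas Δ
  open Logic S Δ
  open SyntaxLemmas S

  infix 2 _⊩_

  _⊩_ : List Formula → Formula → Set₁
  C ⊩ φ = (λ χ → χ ∈ C) ⊢ φ

  weaken : ∀ {Γ Γ' φ} → (∀ χ → Γ χ → Γ' χ) → Γ ⊢ φ → Γ' ⊢ φ
  weaken {Γ' = Γ'} sub d =
    set-ext ((λ χ → [ sub χ , id ]) , (λ χ → inj₂)) (P2 {Γ' = Γ'} d)

  wk : ∀ {C C' φ} → C ⊆ C' → C ⊩ φ → C' ⊩ φ
  wk sub = weaken λ χ → sub

  wk₁ : ∀ {C φ ψ} → C ⊩ φ → ψ ∷ C ⊩ φ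
  wk₁ = wk there

  hyp : ∀ {C φ} → φ ∈ C → C ⊩ φ
  hyp φ∈C = weaken (λ { χ refl → φ∈C }) P1

  hyp₀ : ∀ {C φ} → φ ∷ C ⊩ φ
  hyp₀ = hyp (here refl)

  private
    uncons : ∀ {C φ ψ} → φ ∷ C ⊩ ψ → (λ χ → χ ∈ C) ∪ ｛ φ ｝ ⊢ ψ
    uncons = weaken λ { χ (here eq) → inj₂ eq ; χ (there χ∈C) → inj₁ χ∈C }

  cut : ∀ {C φ ψ} → C ⊩ φ → φ ∷ C ⊩ ψ → C ⊩ ψ
  cut d e = P3 d (uncons e)

  from₀ : ∀ {C φ} → ∅ ⊢ φ → C ⊩ φ
  from₀ = weaken λ χ ()

  from₁ : ∀ {C φ ψ} → C ⊩ φ → ｛ φ ｝ ⊢ ψ → C ⊩ ψ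
  from₁ d e = P3 d (weaken (λ χ → inj₂) e)

  from₂ : ∀ {C φ ψ χ} → C ⊩ φ → C ⊩ ψ → ｛ φ ⨾ ψ ｝ ⊢ χ → C ⊩ χ
  from₂ d e r = P3 d (P3 (weaken (λ _ → inj₁) e)
    (weaken (λ { _ (inj₁ p) → inj₁ (inj₂ p) ; _ (inj₂ p) → inj₂ p }) r))

  single : ∀ {C φ ψ} → C ⊩ φ → φ ∷ [] ⊩ ψ → C ⊩ ψ
  single d e = cut d (wk (λ { (here p) → here p }) e)

  contra : ∀ {C φ ψ} → C ⊩ φ → C ⊩ ¬ᶠ φ → C ⊩ ψ
  contra d e = from₁ (from₂ d e C3) C2

  ∧i : ∀ {C φ ψ} → C ⊩ φ → C ⊩ ψ → C ⊩ φ ∧ᶠ ψ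
  ∧i d e = from₂ d e ∧-I

  ∧e₁ : ∀ {C φ ψ} → C ⊩ φ ∧ᶠ ψ → C ⊩ φ
  ∧e₁ d = from₁ d ∧-E1

  ∧e₂ : ∀ {C φ ψ} → C ⊩ φ ∧ᶠ ψ → C ⊩ ψ
  ∧e₂ d = from₁ d ∧-E2

  ∨i₁ : ∀ {C φ ψ} → C ⊩ φ → C ⊩ φ ∨ᶠ ψ
  ∨i₁ d = from₁ d ∨-I1

  ∨i₂ : ∀ {C φ ψ} → C ⊩ ψ → C ⊩ φ ∨ᶠ ψ
  ∨i₂ d = from₁ d ∨-I2

  ∨e : ∀ {C φ ψ χ} → C ⊩ φ ∨ᶠ ψ → φ ∷ C ⊩ χ → ψ ∷ C ⊩ χ → C ⊩ χ
  ∨e d e f = P3 d (∨-E (uncons e) (uncons f))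

  def : ∀ {C φ} → C ⊩ φ → C ⊩ Def φ
  def d = from₁ d D1

  drop₁ : ∀ {C} {φ ψ : Formula} → φ ∷ C ⊆ φ ∷ ψ ∷ C
  drop₁ (here p) = here p
  drop₁ (there p) = there (there p)

  cases : ∀ {C} φ {χ} → φ ∷ C ⊩ χ → ¬ᶠ φ ∷ C ⊩ χ → ¬ᶠ Def φ ∷ C ⊩ χ → C ⊩ χ
  cases φ d e f = ∨e (from₀ (C1 {φ})) (∨e hyp₀ (wk drop₁ d) (wk drop₁ e)) f

  -- The only rule producing ⊤ᶠ is D1, applied here to ¬ ⊤ᶠ, whose Def is ⊤ᶠ.
  ⊤i : ∀ {C} → C ⊩ ⊤ᶠ
  ⊤i = cases ⊤ᶠ hyp₀ (def hyp₀) (def hyp₀)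

  -- `mvF` counts bound variables too, as the side conditions of `∃-E` exclude every occurrence and
  -- not only the free ones.
  Below : Var → List Formula → Set
  Below z C = All (λ χ → mvF χ < z) C

  ∃e : ∀ {C x φ ψ} z → C ⊩ ∃ᶠ x φ → φ ⟨ x ≔ var z ⟩ ∷ C ⊩ ψ →
    Below z C → mvF (∃ᶠ x φ) < z → mvF ψ < z → C ⊩ ψ
  ∃e {C} {x} {φ} {ψ} z d e C<z φ<z ψ<z = P3 d (∃-E (uncons e)
    (λ χ χ∈C → fresh-occ χ (All.lookup C<z χ∈C)) (fresh-occ (∃ᶠ x φ) φ<z) (fresh-occ ψ ψ<z))

  ∃i : ∀ {C t x φ} → FreeFor t x φ → C ⊩ φ ⟨ x ≔ t ⟩ → C ⊩ ∃ᶠ x φ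
  ∃i ff d = from₁ d (∃-I ff)

  ∀e : ∀ {C x φ} y → FreeFor (var y) x φ → C ⊩ ∀ᶠ x φ → C ⊩ φ ⟨ x ≔ var y ⟩
  ∀e y ff d = from₂ ⊤i d (∀-E {t = var y} ff)

  ∀e-self : ∀ {C x φ} → C ⊩ ∀ᶠ x φ → C ⊩ φ
  ∀e-self {C} {x} {φ} d = subst (C ⊩_) (psub-self x φ) (∀e x (freeFor-self x φ) d)

  -- `∀-I` forbids `x` to be free in the context. Generalising over the one premise `φ` and cutting
  -- it in afterwards leaves `C` unrestricted.
  ∀-single : ∀ {C x φ ψ} → ¬ Free x φ → φ ∷ [] ⊩ ψ → C ⊩ φ → C ⊩ ∀ᶠ x ψ
  ∀-single x∉ d e = single e (∀-I d λ { χ (here refl) → x∉ })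

  -- As `y` may be free in `C`, `∀-I` is used on the fresh `z`. Instantiating the result at `y`
  -- gives back `φ` literally, and `y` is not free in the formula quantified over `z`, so a second
  -- generalisation from that single premise is allowed.
  generalize : ∀ {C φ} y z → C ⊩ φ ⟨ y ≔ var z ⟩ → Below z C → mvF (∀ᶠ y φ) < z → C ⊩ ∀ᶠ y φ
  generalize {C} {φ} y z d C<z φ<z =
    ∀-single (λ (_ , o) → notFree-rename y φ z≢y o) instance-y
      (∀-I {x = z} d λ χ χ∈C → fresh-free χ (All.lookup C<z χ∈C))
    where
    z∉ : ¬ Occ z (∀ᶠ y φ)
    z∉ = fresh-occ (∀ᶠ y φ) φ<z
    z≢y : z ≢ y
    z≢y = z∉ ∘ inj₁
    instance-y : ∀ᶠ z (φ ⟨ y ≔ var z ⟩) ∷ [] ⊩ φ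
    instance-y = subst (∀ᶠ z (φ ⟨ y ≔ var z ⟩) ∷ [] ⊩_) (psub-roundTrip φ (z∉ ∘ inj₂) (roundTrip-↦ y z))
      (∀e y (freeFor-rename y φ (z∉ ∘ inj₂)) hyp₀)

  -- Signed formulas and the three-valued truth conditions.

  signed : TV → Formula → Formula
  signed 𝐓 φ = φ
  signed 𝐅 φ = ¬ᶠ φ
  signed 𝐔 φ = ¬ᶠ Def φ

  exclusive : ∀ {C} v v' {φ ψ} → v ≢ v' → C ⊩ signed v φ → C ⊩ signed v' φ → C ⊩ ψ
  exclusive 𝐅 𝐅 v≢v' d e = ⊥-elim (v≢v' refl)
  exclusive 𝐔 𝐔 v≢v' d e = ⊥-elim (v≢v' refl)
  exclusive 𝐓 𝐓 v≢v' d e = ⊥-elim (v≢v' refl)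
  exclusive 𝐅 𝐔 v≢v' d e = contra (def d) e
  exclusive 𝐅 𝐓 v≢v' d e = contra e d
  exclusive 𝐔 𝐅 v≢v' d e = contra (def e) d
  exclusive 𝐔 𝐓 v≢v' d e = contra (def e) d
  exclusive 𝐓 𝐅 v≢v' d e = contra d e
  exclusive 𝐓 𝐔 v≢v' d e = contra (def d) e

  exhaust : ∀ {C} φ {χ} → (∀ v → signed v φ ∷ C ⊩ χ) → C ⊩ χ
  exhaust φ h = cases φ (h 𝐓) (h 𝐅) (h 𝐔)

  signed-¬ : ∀ {C} v {φ} → C ⊩ signed v (¬ᶠ φ) → C ⊩ signed (negᵗ v) φ
  signed-¬ 𝐅 {φ} d = cases φ hyp₀ (contra hyp₀ (wk₁ d)) (contra (def (wk₁ d)) hyp₀)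
  signed-¬ 𝐔 d = d
  signed-¬ 𝐓 d = d

  -- Refuting a formula shows only that it is false or undefined, so there is no general
  -- introduction of negation. Here `C1` is applied to `χ` itself: two of its cases yield `Def χ`
  -- and are refuted, the third is the claim.
  undefined : ∀ {C} χ → Def χ ∷ C ⊩ ⊥ᶠ → C ⊩ ¬ᶠ Def χ
  undefined χ d = cases χ (cut (def hyp₀) (from₁ (wk drop₁ d) C2))
    (cut (def hyp₀) (from₁ (wk drop₁ d) C2)) hyp₀

  -- `Def χ` lists the ways in which a conjunction is defined: both parts are, or one part is false.
  -- A false part therefore proves `Def χ`, and in the U cases each disjunct clashes with the given
  -- signs.
  signed-∧ : ∀ {C φ ψ} a b → C ⊩ signed a φ → C ⊩ signed b ψ → C ⊩ signed (minᵗ a b) (φ ∧ᶠ ψ)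
  signed-∧ {C} {φ} {ψ} = go
    where
    χ = φ ∧ᶠ ψ
    falseˡ : C ⊩ ¬ᶠ φ → C ⊩ ¬ᶠ χ
    falseˡ d = cases χ (contra (∧e₁ hyp₀) (wk₁ d)) hyp₀
      (contra (wk₁ (∨i₁ (∨i₂ (∧i (def d) d)))) hyp₀)
    falseʳ : C ⊩ ¬ᶠ ψ → C ⊩ ¬ᶠ χ
    falseʳ d = cases χ (contra (∧e₂ hyp₀) (wk₁ d)) hyp₀
      (contra (wk₁ (∨i₂ (∧i (def d) d))) hyp₀)
    go : ∀ a b → C ⊩ signed a φ → C ⊩ signed b ψ → C ⊩ signed (minᵗ a b) χ
    go 𝐅 b d e = falseˡ d
    go 𝐔 𝐅 d e = falseʳ e
    go 𝐓 𝐅 d e = falseʳ e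
    go 𝐔 𝐔 d e = undefined χ (∨e hyp₀
      (∨e hyp₀ (contra (∧e₁ hyp₀) (wk₁ (wk₁ (wk₁ d)))) (contra (∧e₁ hyp₀) (wk₁ (wk₁ (wk₁ d)))))
      (contra (∧e₁ hyp₀) (wk₁ (wk₁ e))))
    go 𝐔 𝐓 d e = undefined χ (∨e hyp₀
      (∨e hyp₀ (contra (∧e₁ hyp₀) (wk₁ (wk₁ (wk₁ d)))) (contra (∧e₁ hyp₀) (wk₁ (wk₁ (wk₁ d)))))
      (contra (wk₁ (wk₁ e)) (∧e₂ hyp₀)))
    go 𝐓 𝐔 d e = undefined χ (∨e hyp₀
      (∨e hyp₀ (contra (∧e₂ hyp₀) (wk₁ (wk₁ (wk₁ e)))) (contra (wk₁ (wk₁ (wk₁ d))) (∧e₂ hyp₀)))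
      (contra (∧e₁ hyp₀) (wk₁ (wk₁ e))))
    go 𝐓 𝐓 d e = ∧i d e

  signed-∨ : ∀ {C φ ψ} a b → C ⊩ signed a φ → C ⊩ signed b ψ → C ⊩ signed (maxᵗ a b) (φ ∨ᶠ ψ)
  signed-∨ {C} {φ} {ψ} = go
    where
    χ = φ ∨ᶠ ψ
    go : ∀ a b → C ⊩ signed a φ → C ⊩ signed b ψ → C ⊩ signed (maxᵗ a b) χ
    go 𝐓 b d e = ∨i₁ d
    go 𝐔 𝐓 d e = ∨i₂ e
    go 𝐅 𝐓 d e = ∨i₂ e
    go 𝐔 𝐔 d e = undefined χ (∨e hyp₀
      (∨e hyp₀ (contra (∧e₁ hyp₀) (wk₁ (wk₁ (wk₁ d)))) (contra (∧e₁ hyp₀) (wk₁ (wk₁ (wk₁ d)))))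
      (contra (∧e₁ hyp₀) (wk₁ (wk₁ e))))
    go 𝐔 𝐅 d e = undefined χ (∨e hyp₀
      (∨e hyp₀ (contra (∧e₁ hyp₀) (wk₁ (wk₁ (wk₁ d)))) (contra (∧e₁ hyp₀) (wk₁ (wk₁ (wk₁ d)))))
      (contra (∧e₂ hyp₀) (wk₁ (wk₁ e))))
    go 𝐅 𝐔 d e = undefined χ (∨e hyp₀
      (∨e hyp₀ (contra (∧e₂ hyp₀) (wk₁ (wk₁ (wk₁ e)))) (contra (∧e₂ hyp₀) (wk₁ (wk₁ (wk₁ d)))))
      (contra (∧e₁ hyp₀) (wk₁ (wk₁ e))))
    go 𝐅 𝐅 d e = cases χ
      (∨e hyp₀ (contra hyp₀ (wk₁ (wk₁ d))) (contra hyp₀ (wk₁ (wk₁ e)))) hyp₀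
      (contra (wk₁ (∨i₁ (∨i₁ (∧i (def d) (def e))))) hyp₀)

  -- Def (∀ᶠ y φ) and Def (∃ᶠ y (¬ᶠ φ)) are the same formula. This turns a false instance into
  -- Def (∀ᶠ y φ) without comparing Def (φ ⟨ y ≔ t ⟩) with (Def φ) ⟨ y ≔ t ⟩.
  false-instance : ∀ {C y φ t} → FreeFor t y φ → C ⊩ ¬ᶠ (φ ⟨ y ≔ t ⟩) → C ⊩ Def (∀ᶠ y φ)
  false-instance {φ = φ} ff d = def (∃i {φ = ¬ᶠ φ} ff d)

  private
    -- Instances of `φ ∨ᶠ ¬ᶠ φ` are decided instances of `φ`, whereas instances of `Def φ` need not
    -- be of the form `Def`. The converse below returns a generalisation over instances to `Def φ`.
    all-defined⇒decided : ∀ {C} y φ → C ⊩ ∀ᶠ y (Def φ) → C ⊩ ∀ᶠ y (φ ∨ᶠ ¬ᶠ φ)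
    all-defined⇒decided y φ = ∀-single (λ (y≢y , _) → y≢y refl)
      (cases φ (∨i₁ hyp₀) (∨i₂ hyp₀) (contra (wk₁ (∀e-self hyp₀)) hyp₀))

    all-decided⇒defined : ∀ {C} y φ → C ⊩ ∀ᶠ y (φ ∨ᶠ ¬ᶠ φ) → C ⊩ ∀ᶠ y (Def φ)
    all-decided⇒defined y φ = ∀-single (λ (y≢y , _) → y≢y refl)
      (∨e (∀e-self hyp₀) (def hyp₀) (def hyp₀))

  ∃-∧e₂ : ∀ {C y φ ψ} → C ⊩ ∃ᶠ y (φ ∧ᶠ ψ) → C ⊩ ∃ᶠ y ψ
  ∃-∧e₂ {y = y} {φ} {ψ} d = single d
    (∃e z hyp₀ (∃i (freeFor-fresh y ψ (fresh-occ (∃ᶠ y ψ) ψ<z ∘ inj₂)) (∧e₂ hyp₀))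
      (≤-refl ∷ []) ≤-refl ψ<z)
    where
    z : Var
    z = suc (mvF (∃ᶠ y (φ ∧ᶠ ψ)))
    ψ<z : mvF (∃ᶠ y ψ) < z
    ψ<z = s≤s (⊔-mono-≤ (≤-refl {y}) (m≤n⊔m (mvF φ) (mvF ψ)))

  -- In the linear order, `minᵗ v a ≢ v` means that the instance has a value strictly below that of
  -- the universal formula.
  contradictory-∀ : ∀ {C y φ t} v a → FreeFor (var t) y φ → minᵗ v a ≢ v →
    C ⊩ signed v (∀ᶠ y φ) → C ⊩ signed a (φ ⟨ y ≔ var t ⟩) → C ⊩ ⊥ᶠ
  contradictory-∀ 𝐅 a ff m≢ d e = ⊥-elim (m≢ refl)
  contradictory-∀ 𝐔 𝐅 ff m≢ d e = contra (false-instance ff e) d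
  contradictory-∀ 𝐔 𝐔 ff m≢ d e = ⊥-elim (m≢ refl)
  contradictory-∀ 𝐔 𝐓 ff m≢ d e = ⊥-elim (m≢ refl)
  contradictory-∀ 𝐓 a ff m≢ d e = exclusive 𝐓 a (m≢ ∘ sym) (∀e _ ff d) e

  contradictory-∃ : ∀ {C y φ t} v a → FreeFor (var t) y φ → maxᵗ v a ≢ v →
    C ⊩ signed v (∃ᶠ y φ) → C ⊩ signed a (φ ⟨ y ≔ var t ⟩) → C ⊩ ⊥ᶠ
  contradictory-∃ 𝐓 a ff m≢ d e = ⊥-elim (m≢ refl)
  contradictory-∃ 𝐔 𝐓 ff m≢ d e = contra (def (∃i ff e)) d
  contradictory-∃ 𝐔 𝐔 ff m≢ d e = ⊥-elim (m≢ refl)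
  contradictory-∃ 𝐔 𝐅 ff m≢ d e = ⊥-elim (m≢ refl)
  contradictory-∃ 𝐅 𝐓 ff m≢ d e = contra (∃i ff e) d
  -- A false existential formula is defined. Either all its instances are defined, so the given one
  -- is decided and cannot have sign U, or one of them is true, which contradicts falsity.
  contradictory-∃ {φ = φ} 𝐅 𝐔 ff m≢ d e = ∨e (def d)
    (∨e (∀e _ (ff , ff) (all-defined⇒decided _ φ hyp₀))
      (contra (def hyp₀) (wk₁ (wk₁ e))) (contra (def hyp₀) (wk₁ (wk₁ e))))
    (contra (∃-∧e₂ hyp₀) (wk₁ d))
  contradictory-∃ 𝐅 𝐅 ff m≢ d e = ⊥-elim (m≢ refl)

  -- This one bound dominates every formula used below. Since `mvF` ignores negation, a bound on
  -- `Def (∃ᶠ y φ)` serves equally well.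
  module FreshInstance {C} (y z : Var) (φ : Formula) (C<z : Below z C)
    (Def<z : mvF (Def (∀ᶠ y φ)) < z) where

    φz : Formula
    φz = φ ⟨ y ≔ var z ⟩

    ∃<z : mvF (∃ᶠ y (Def φ ∧ᶠ φ)) < z
    ∃<z = ≤-<-trans (m≤n⊔m (y ⊔ mvF (Def φ)) _) Def<z

    φ<z : mvF (∀ᶠ y φ) < z
    φ<z = ≤-<-trans (⊔-mono-≤ (≤-refl {y}) (m≤n⊔m (mvF (Def φ)) _)) ∃<z

    ∀Def<z : mvF (∀ᶠ y (Def φ)) < z
    ∀Def<z = ≤-<-trans (m≤m⊔n (y ⊔ mvF (Def φ)) _) Def<z

    ff : FreeFor (var z) y φ
    ff = freeFor-fresh y φ (fresh-occ (∀ᶠ y φ) φ<z ∘ inj₂)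

    0<z : 0 < z
    0<z = ≤-<-trans z≤n φ<z

    -- If the instance at a fresh variable cannot be undefined, `C1` decides it. Generalising gives
    -- decidedness everywhere, hence the first disjunct of the definedness of either quantified
    -- formula.
    undefined-instance : signed 𝐔 φz ∷ C ⊩ ⊥ᶠ → C ⊩ ∀ᶠ y (Def φ)
    undefined-instance r = all-decided⇒defined y φ
      (generalize y z (cases φz (∨i₁ hyp₀) (∨i₂ hyp₀) (from₁ r C2)) C<z
        (subst (_< z) (cong (y ⊔_) (sym (⊔-idem (mvF φ)))) φ<z))

    decided-instance : ∀ {C} → C ⊩ ∀ᶠ y (Def φ) → C ⊩ φz ∨ᶠ ¬ᶠ φz
    decided-instance d = ∀e z (ff , ff) (all-defined⇒decided y φ d)

    -- No rule leads from a false universal formula to a counterexample; its definedness, available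
    -- by `D1`, does. If all instances are defined and the fresh one is not false, it is true and
    -- generalising contradicts falsity; otherwise the second disjunct supplies a false instance.
    attained-∀ : ∀ v → C ⊩ signed v (∀ᶠ y φ) → signed v φz ∷ C ⊩ ⊥ᶠ → C ⊩ ⊥ᶠ
    attained-∀ 𝐓 d r = cut (∀e z ff d) r
    attained-∀ 𝐔 d r = contra (∨i₁ (undefined-instance r)) d
    attained-∀ 𝐅 d r = ∨e (def d)
      (contra
        (generalize y z
          (∨e (decided-instance hyp₀) hyp₀ (from₁ (wk drop₁ r) C2)) (∀Def<z ∷ C<z) φ<z)
        (wk₁ d))
      (∃e z hyp₀ (cut (∧e₂ hyp₀) (wk (drop₁ ∘ drop₁) r)) (∃<z ∷ C<z) ∃<z 0<z)

    attained-∃ : ∀ v → C ⊩ signed v (∃ᶠ y φ) → signed v φz ∷ C ⊩ ⊥ᶠ → C ⊩ ⊥ᶠ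
    attained-∃ 𝐓 d r = ∃e z d r C<z φ<z 0<z
    attained-∃ 𝐔 d r = contra (∨i₁ (undefined-instance r)) d
    attained-∃ 𝐅 d r = ∨e (def d)
      (∨e (decided-instance hyp₀) (contra (∃i ff hyp₀) (wk₁ (wk₁ d))) (wk drop₁ r))
      (∃e z hyp₀ (contra (∃i ff (∧e₂ hyp₀)) (wk₁ (wk₁ d))) (∃<z ∷ C<z) ∃<z 0<z)

  -- Equality, congruence and definedness of terms.

  ≈-Def : ∀ {C s t} → C ⊩ s ≈ᶠ t → C ⊩ DefT s
  ≈-Def d = ∧e₁ (def d)

  ≈-refl : ∀ {C t} → C ⊩ DefT t → C ⊩ t ≈ᶠ t
  ≈-refl d = from₁ d =-1

  replace : ∀ {C t t'} φ x → FreeFor t x φ → FreeFor t' x φ →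
    C ⊩ t ≈ᶠ t' → C ⊩ φ ⟨ x ≔ t ⟩ → C ⊩ φ ⟨ x ≔ t' ⟩
  replace {t = t} {t'} φ x ff ff' d e = from₂ d e
    (=-2 φ (x ∷ []) (λ { zero zero _ → refl }) (t ∷ []) zero t' (λ { zero → ff }) ff')

  ≈-replaceˡ : ∀ {C t t' u} → C ⊩ t ≈ᶠ t' → C ⊩ t ≈ᶠ u → C ⊩ t' ≈ᶠ u
  ≈-replaceˡ {C} {t} {t'} {u} d e = subst (C ⊩_) (eq t') (replace (var x ≈ᶠ u) x tt tt d
    (subst (C ⊩_) (sym (eq t)) e))
    where
    x : Var
    x = suc (mvT u)
    eq : ∀ s → (var x ≈ᶠ u) ⟨ x ≔ s ⟩ ≡ s ≈ᶠ u
    eq s = cong₂ _≈ᶠ_ (if-≡ {x = x} refl) (substT-fresh u ≤-refl)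

  ≈-sym : ∀ {C s t} → C ⊩ s ≈ᶠ t → C ⊩ t ≈ᶠ s
  ≈-sym d = ≈-replaceˡ d (≈-refl (≈-Def d))

  ≈-trans : ∀ {C s t u} → C ⊩ s ≈ᶠ t → C ⊩ t ≈ᶠ u → C ⊩ s ≈ᶠ u
  ≈-trans d e = ≈-replaceˡ (≈-sym d) e

  -- Arguments are replaced one at a time, each finished argument being absorbed into `P`. The
  -- number `m` bounds the variables hidden in `P`, so a larger hole variable touches only the
  -- arguments still exposed.
  replaceAll : ∀ {C n} (P : Vec Term n → Formula) m → (∀ t x ts → FreeFor t x (P ts)) →
    (∀ x t ts → m < x → P ts ⟨ x ≔ t ⟩ ≡ P (substTs (var [ x ↦ t ]) ts)) →
    ∀ ts us → (∀ i → C ⊩ lookup ts i ≈ᶠ lookup us i) → C ⊩ P ts → C ⊩ P us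
  replaceAll P m ff P-subst [] [] eqs d = d
  replaceAll {C} {suc n} P m ff P-subst (t ∷ ts) (u ∷ us) eqs d =
    replaceAll (P ∘ (u ∷_)) (m ⊔ mvT u) (λ s x ss → ff s x (u ∷ ss)) tail-subst ts us (eqs ∘ suc)
      (subst (C ⊩_) (eq u) (replace (P (var x ∷ ts)) x (ff _ _ _) (ff _ _ _) (eqs zero)
        (subst (C ⊩_) (sym (eq t)) d)))
    where
    x : Var
    x = suc (m ⊔ mvTs ts)
    eq : ∀ s → P (var x ∷ ts) ⟨ x ≔ s ⟩ ≡ P (s ∷ ts)
    eq s = trans (P-subst x s (var x ∷ ts) (s≤s (m≤m⊔n m _)))
      (cong P (cong₂ _∷_ (if-≡ {x = x} refl) (substTs-fresh ts (s≤s (m≤n⊔m m _)))))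
    tail-subst : ∀ x s ss → m ⊔ mvT u < x →
      P (u ∷ ss) ⟨ x ≔ s ⟩ ≡ P (u ∷ substTs (var [ x ↦ s ]) ss)
    tail-subst x s ss m<x = trans (P-subst x s (u ∷ ss) (≤-<-trans (m≤m⊔n m _) m<x))
      (cong (λ w → P (w ∷ substTs (var [ x ↦ s ]) ss))
        (substT-fresh u (≤-<-trans (m≤n⊔m m _) m<x)))

  app-cong : ∀ {C f v} ts us → (∀ i → C ⊩ lookup ts i ≈ᶠ lookup us i) →
    C ⊩ app f ts ≈ᶠ v → C ⊩ app f us ≈ᶠ v
  app-cong {f = f} {v} = replaceAll (λ ts → app f ts ≈ᶠ v) (mvT v) (λ _ _ _ → tt)
    λ x t ts v<x → cong (app f (substTs _ ts) ≈ᶠ_) (substT-fresh v v<x)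

  rel-cong : ∀ {C R} v ts us → v ≢ 𝐔 → (∀ i → C ⊩ lookup ts i ≈ᶠ lookup us i) →
    C ⊩ signed v (rel R ts) → C ⊩ signed v (rel R us)
  rel-cong {R = R} 𝐅 ts us v≢U = replaceAll (λ ts → ¬ᶠ rel R ts) 0 (λ _ _ _ → tt) (λ _ _ _ _ → refl) ts us
  rel-cong 𝐔 ts us v≢U = ⊥-elim (v≢U refl)
  rel-cong {R = R} 𝐓 ts us v≢U = replaceAll (rel R) 0 (λ _ _ _ → tt) (λ _ _ _ _ → refl) ts us

  foldl-∧e : ∀ {C φ} ψ φs → φ ∈ ψ ∷ φs → C ⊩ foldl _∧ᶠ_ ψ φs → C ⊩ φ
  foldl-∧e ψ [] (here refl) d = d
  foldl-∧e ψ (χ ∷ φs) (here refl) d = ∧e₁ (foldl-∧e _ φs (here refl) d)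
  foldl-∧e ψ (χ ∷ φs) (there (here refl)) d = ∧e₂ (foldl-∧e _ φs (here refl) d)
  foldl-∧e ψ (χ ∷ φs) (there (there p)) d = foldl-∧e _ φs (there p) d

  conj-e : ∀ {C φ} φs → φ ∈ φs → C ⊩ conj φs → C ⊩ φ
  conj-e (ψ ∷ φs) p d = foldl-∧e ψ φs p d

  foldl-∧i : ∀ {C ψ} φs → C ⊩ ψ → (∀ {φ} → φ ∈ φs → C ⊩ φ) → C ⊩ foldl _∧ᶠ_ ψ φs
  foldl-∧i [] d ds = d
  foldl-∧i (χ ∷ φs) d ds = foldl-∧i φs (∧i d (ds (here refl))) (ds ∘ there)

  conj-i : ∀ {C} φs → (∀ {φ} → φ ∈ φs → C ⊩ φ) → C ⊩ conj φs
  conj-i [] ds = ⊤i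
  conj-i (ψ ∷ φs) ds = foldl-∧i φs (ds (here refl)) (ds ∘ there)

  DefTs-∈ : ∀ {n} (ts : Vec Term n) i → DefT (lookup ts i) ∈ DefTs ts
  DefTs-∈ (t ∷ ts) zero = here refl
  DefTs-∈ (t ∷ ts) (suc i) = there (DefTs-∈ ts i)

  ∈-DefTs : ∀ {n φ} (ts : Vec Term n) → φ ∈ DefTs ts → Σ (Fin n) λ i → φ ≡ DefT (lookup ts i)
  ∈-DefTs (t ∷ ts) (here refl) = zero , refl
  ∈-DefTs (t ∷ ts) (there p) = let i , eq = ∈-DefTs ts p in suc i , eq

  Def-arg : ∀ {C} f ts i → C ⊩ DefT (app f ts) → C ⊩ DefT (lookup ts i)
  Def-arg f ts i = conj-e _ (∈-++⁺ˡ (DefTs-∈ ts i))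

  Def-δ : ∀ {C} f ts → C ⊩ DefT (app f ts) → C ⊩ instδ f ts
  Def-δ f ts = conj-e _ (∈-++⁺ʳ (DefTs ts) (here refl))

  Def-app : ∀ {C} f ts → (∀ i → C ⊩ DefT (lookup ts i)) → C ⊩ instδ f ts → C ⊩ DefT (app f ts)
  Def-app {C} f ts ds d = conj-i _ λ p → case ∈-++⁻ (DefTs ts) p of λ where
    (inj₁ q) → let i , eq = ∈-DefTs ts q in subst (C ⊩_) (sym eq) (ds i)
    (inj₂ (here refl)) → d

  Def-rel-arg : ∀ {C} R ts i → C ⊩ Def (rel R ts) → C ⊩ DefT (lookup ts i)
  Def-rel-arg R ts i = conj-e _ (DefTs-∈ ts i)

  Def-rel : ∀ {C} R ts → (∀ i → C ⊩ DefT (lookup ts i)) → C ⊩ Def (rel R ts)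
  Def-rel {C} R ts ds = conj-i _ λ p → let i , eq = ∈-DefTs ts p in subst (C ⊩_) (sym eq) (ds i)

  -- `C1` splits on formulas, not on terms. Since the definedness of `t ≈ᶠ t` is `DefT t ∧ᶠ DefT t`,
  -- this form makes undefinedness of a term an instance of the sign U.
  Undefined : Term → Formula
  Undefined t = ¬ᶠ Def (t ≈ᶠ t)

  Undefined-contra : ∀ {C} t {φ} → C ⊩ DefT t → C ⊩ Undefined t → C ⊩ φ
  Undefined-contra t d e = contra (∧i d d) e

  Def-cases : ∀ {C} t {φ} → DefT t ∷ C ⊩ φ → Undefined t ∷ C ⊩ φ → C ⊩ φ
  Def-cases t d e = cases (t ≈ᶠ t) (cut (≈-Def hyp₀) (wk drop₁ d))
    (cut (∧e₁ (def hyp₀)) (wk drop₁ d)) e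

  Def-casesAll : ∀ {C n} (ts : Vec Term n) {φ} → (∀ i → Undefined (lookup ts i) ∷ C ⊩ φ) →
    (∀ {C'} → C ⊆ C' → (∀ i → C' ⊩ DefT (lookup ts i)) → C' ⊩ φ) → C ⊩ φ
  Def-casesAll [] u d = d id λ ()
  Def-casesAll (t ∷ ts) u d = Def-cases t
    (Def-casesAll ts (λ i → wk (λ { (here p) → here p ; (there p) → there (there p) }) (u (suc i)))
      λ sub ds → d (sub ∘ there) λ { zero → hyp (sub (here refl)) ; (suc i) → ds i })
    (u zero)

  -- By `=-1` and `∃-I` some `x` equals `t`, and eliminating this existential formula names `t` by
  -- `z`. The bound lies above `suc (mvT t)` because that number is the bound variable `x`.
  name : ∀ {C} t z → Below z C → suc (mvT t) < z → C ⊩ DefT t → t ≈ᶠ var z ∷ C ⊩ ⊥ᶠ → C ⊩ ⊥ᶠ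
  name {C} t z C<z t<z d r = ∃e z
    (∃i {t = t} {x} {t ≈ᶠ var x} tt (subst (C ⊩_) (sym (eq t)) (≈-refl d)))
    (subst (λ φ → φ ∷ C ⊩ ⊥ᶠ) (sym (eq (var z))) r) C<z
    (⊔-lub t<z (⊔-lub (<-trans ≤-refl t<z) t<z)) (≤-<-trans z≤n t<z)
    where
    x : Var
    x = suc (mvT t)
    eq : ∀ u → (t ≈ᶠ var x) ⟨ x ≔ u ⟩ ≡ t ≈ᶠ u
    eq u = cong₂ _≈ᶠ_ (substT-fresh t ≤-refl) (if-≡ {x = x} refl)

-- Instances of a formula up to the choice of bound variables.

module Instances (S : Signature) where
  open Syntax S
  open SyntaxLemmas S

  _[_↤_] : (ℕ → ℕ) → ℕ → ℕ → ℕ → ℕ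
  (e [ x ↤ y ]) v = if v ≡ᵇ x then y else e v

  ↤-≡ : ∀ e x {y} → (e [ x ↤ y ]) x ≡ y
  ↤-≡ e x = if-≡ {x = x} refl

  ↤-≢ : ∀ {e x y v} → v ≢ x → (e [ x ↤ y ]) v ≡ e v
  ↤-≢ = if-≢

  -- Inst e φ χ: up to renaming of bound variables, χ is φ with every free v replaced by e v.
  data Inst (e : Var → Var) : Formula → Formula → Set where
    i-⊥ : Inst e ⊥ᶠ ⊥ᶠ
    i-⊤ : Inst e ⊤ᶠ ⊤ᶠ
    i-≈ : ∀ {s t s' t'} → s' ≡ substT (var ∘ e) s → t' ≡ substT (var ∘ e) t → Inst e (s ≈ᶠ t) (s' ≈ᶠ t')
    i-rel : ∀ {R ts ts'} → ts' ≡ substTs (var ∘ e) ts → Inst e (rel R ts) (rel R ts')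
    i-¬ : ∀ {φ χ} → Inst e φ χ → Inst e (¬ᶠ φ) (¬ᶠ χ)
    i-∧ : ∀ {φ ψ χ ξ} → Inst e φ χ → Inst e ψ ξ → Inst e (φ ∧ᶠ ψ) (χ ∧ᶠ ξ)
    i-∨ : ∀ {φ ψ χ ξ} → Inst e φ χ → Inst e ψ ξ → Inst e (φ ∨ᶠ ψ) (χ ∨ᶠ ξ)
    i-∀ : ∀ {x y φ χ} → Inst (e [ x ↤ y ]) φ χ → (∀ v → Free v (∀ᶠ x φ) → e v ≢ y) →
      Inst e (∀ᶠ x φ) (∀ᶠ y χ)
    i-∃ : ∀ {x y φ χ} → Inst (e [ x ↤ y ]) φ χ → (∀ v → Free v (∃ᶠ x φ) → e v ≢ y) →
      Inst e (∃ᶠ x φ) (∃ᶠ y χ)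

  private
    binder-cong : ∀ {e e' x y} φ → (∀ v → v ≢ x × Free v φ → e v ≡ e' v) →
      ∀ v → Free v φ → (e [ x ↤ y ]) v ≡ (e' [ x ↤ y ]) v
    binder-cong {e} {e'} {x} φ h v o with v ≟ x
    ... | yes refl = trans (↤-≡ e v) (sym (↤-≡ e' v))
    ... | no v≢x = trans (↤-≢ {e} v≢x) (trans (h v (v≢x , o)) (sym (↤-≢ {e'} v≢x)))

  Inst-cong : ∀ {e e' φ χ} → (∀ v → Free v φ → e v ≡ e' v) → Inst e φ χ → Inst e' φ χ
  Inst-cong h i-⊥ = i-⊥
  Inst-cong h i-⊤ = i-⊤
  Inst-cong h (i-≈ {s} {t} p q) = i-≈
    (trans p (substT-cong s λ v o → cong var (h v (inj₁ o))))
    (trans q (substT-cong t λ v o → cong var (h v (inj₂ o))))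
  Inst-cong h (i-rel {R} {ts} p) = i-rel (trans p (substTs-cong ts λ v o → cong var (h v o)))
  Inst-cong h (i-¬ i) = i-¬ (Inst-cong h i)
  Inst-cong h (i-∧ i j) = i-∧ (Inst-cong (λ v → h v ∘ inj₁) i) (Inst-cong (λ v → h v ∘ inj₂) j)
  Inst-cong h (i-∨ i j) = i-∨ (Inst-cong (λ v → h v ∘ inj₁) i) (Inst-cong (λ v → h v ∘ inj₂) j)
  Inst-cong {e} {e'} h (i-∀ {φ = φ} i y∉) = i-∀ (Inst-cong (binder-cong {e} {e'} φ h) i)
    λ v o eq → y∉ v o (trans (h v o) eq)
  Inst-cong {e} {e'} h (i-∃ {φ = φ} i y∉) = i-∃ (Inst-cong (binder-cong {e} {e'} φ h) i)
    λ v o eq → y∉ v o (trans (h v o) eq)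

  private
    binder-id : ∀ {e x} φ → (∀ v → v ≢ x × Free v φ → e v ≡ v) → ∀ v → Free v φ → (e [ x ↤ x ]) v ≡ v
    binder-id {e} {x} φ h v o with v ≟ x
    ... | yes refl = ↤-≡ e v
    ... | no v≢x = trans (↤-≢ {e} v≢x) (h v (v≢x , o))

  Inst-id : ∀ {e} φ → (∀ v → Free v φ → e v ≡ v) → Inst e φ φ
  Inst-id ⊥ᶠ h = i-⊥
  Inst-id ⊤ᶠ h = i-⊤
  Inst-id (s ≈ᶠ t) h = i-≈ (sym (substT-id s λ v o → cong var (h v (inj₁ o))))
    (sym (substT-id t λ v o → cong var (h v (inj₂ o))))
  Inst-id (rel R ts) h = i-rel (sym (substTs-id ts λ v o → cong var (h v o)))
  Inst-id (¬ᶠ φ) h = i-¬ (Inst-id φ h)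
  Inst-id (φ ∧ᶠ ψ) h = i-∧ (Inst-id φ λ v → h v ∘ inj₁) (Inst-id ψ λ v → h v ∘ inj₂)
  Inst-id (φ ∨ᶠ ψ) h = i-∨ (Inst-id φ λ v → h v ∘ inj₁) (Inst-id ψ λ v → h v ∘ inj₂)
  Inst-id {e} (∀ᶠ x φ) h = i-∀ (Inst-id φ (binder-id {e} φ h)) λ { v o refl → proj₁ o (sym (h v o)) }
  Inst-id {e} (∃ᶠ x φ) h = i-∃ (Inst-id φ (binder-id {e} φ h)) λ { v o refl → proj₁ o (sym (h v o)) }

  CaptureFree : (Var → Var) → Formula → Set
  CaptureFree r χ = ∀ y w → Occ y χ → w ≢ y → r w ≢ y

  private
    module Binder {s : Subst} {r : Var → Var} (s-r : ∀ w → s w ≡ var (r w)) (y : Var) where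
      s-r' : ∀ w → (s [ y ↦ var y ]) w ≡ var ((r [ y ↤ y ]) w)
      s-r' w with w ≡ᵇ y
      ... | true = refl
      ... | false = s-r w

      capture : ∀ {χ} → (∀ z w → z ≡ y ⊎ Occ z χ → w ≢ z → r w ≢ z) → CaptureFree (r [ y ↤ y ]) χ
      capture cf z w o w≢z eq with w ≟ y
      ... | yes refl = w≢z (trans (sym (↤-≡ r w)) eq)
      ... | no w≢y = cf z w (inj₂ o) w≢z (trans (sym (↤-≢ {r} w≢y)) eq)

      env : ∀ {e x} φ → (∀ v → v ≢ x × Free v φ → e v ≢ y) →
        ∀ v → Free v φ → (r [ y ↤ y ]) ((e [ x ↤ y ]) v) ≡ ((r ∘ e) [ x ↤ y ]) v
      env {e} {x} φ y∉ v o with v ≟ x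
      ... | yes refl = trans (cong (r [ y ↤ y ]) (↤-≡ e v))
                         (trans (↤-≡ r y) (sym (↤-≡ (r ∘ e) v)))
      ... | no v≢x = trans (cong (r [ y ↤ y ]) (↤-≢ {e} v≢x))
                       (trans (↤-≢ {r} (y∉ v (v≢x , o))) (sym (↤-≢ {r ∘ e} v≢x)))

  Inst-psub : ∀ {e φ χ s r} → (∀ w → s w ≡ var (r w)) → CaptureFree r χ → Inst e φ χ →
    Inst (r ∘ e) φ (psub s χ)
  Inst-psub s-r cf i-⊥ = i-⊥
  Inst-psub s-r cf i-⊤ = i-⊤
  Inst-psub s-r cf (i-≈ {s} {t} refl refl) = i-≈
    (trans (substT-∘ s) (substT-cong s λ v _ → s-r _)) (trans (substT-∘ t) (substT-cong t λ v _ → s-r _))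
  Inst-psub s-r cf (i-rel {R} {ts} refl) = i-rel (trans (substTs-∘ ts) (substTs-cong ts λ v _ → s-r _))
  Inst-psub s-r cf (i-¬ i) = i-¬ (Inst-psub s-r cf i)
  Inst-psub s-r cf (i-∧ i j) = i-∧ (Inst-psub s-r (λ y w → cf y w ∘ inj₁) i)
    (Inst-psub s-r (λ y w → cf y w ∘ inj₂) j)
  Inst-psub s-r cf (i-∨ i j) = i-∨ (Inst-psub s-r (λ y w → cf y w ∘ inj₁) i)
    (Inst-psub s-r (λ y w → cf y w ∘ inj₂) j)
  Inst-psub {e} {s = s} s-r cf (i-∀ {x} {y} {φ} {χ} i y∉) = i-∀
    (Inst-cong (B.env {e} φ y∉)
      (Inst-psub {s = s [ y ↦ var y ]} B.s-r' (B.capture {χ} cf) i))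
    λ v o → cf y (e v) (inj₁ refl) (y∉ v o)
    where module B = Binder {s} s-r y
  Inst-psub {e} {s = s} s-r cf (i-∃ {x} {y} {φ} {χ} i y∉) = i-∃
    (Inst-cong (B.env {e} φ y∉)
      (Inst-psub {s = s [ y ↦ var y ]} B.s-r' (B.capture {χ} cf) i))
    λ v o → cf y (e v) (inj₁ refl) (y∉ v o)
    where module B = Binder {s} s-r y

  -- Opens a quantifier of an instance: `x` is the bound name in the pattern, `y` the one in the
  -- actual formula. What the calculus literally produces at `z` is again an instance of the body.
  Inst-fresh : ∀ {e x y z φ χ} → (∀ v → v ≢ x × Free v φ → e v ≢ y) → ¬ Occ z χ →
    Inst (e [ x ↤ y ]) φ χ → Inst (e [ x ↤ z ]) φ (χ ⟨ y ≔ var z ⟩)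
  Inst-fresh {e} {x} {y} {z} {φ} {χ} y∉ z∉ i =
    Inst-cong agree (Inst-psub {r = id [ y ↤ z ]} s-r cf i)
    where
    s-r : ∀ w → (var [ y ↦ var z ]) w ≡ var ((id [ y ↤ z ]) w)
    s-r w with w ≡ᵇ y
    ... | true = refl
    ... | false = refl
    cf : CaptureFree (id [ y ↤ z ]) χ
    cf u w o w≢u eq with w ≟ y
    ... | yes refl = z∉ (subst (λ a → Occ a χ) (trans (sym eq) (↤-≡ id w)) o)
    ... | no w≢y = w≢u (trans (sym (↤-≢ {id} w≢y)) eq)
    agree : ∀ v → Free v φ → (id [ y ↤ z ]) ((e [ x ↤ y ]) v) ≡ (e [ x ↤ z ]) v
    agree v o with v ≟ x
    ... | yes refl = trans (cong (id [ y ↤ z ]) (↤-≡ e v)) (trans (↤-≡ id y) (sym (↤-≡ e v)))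
    ... | no v≢x = trans (cong (id [ y ↤ z ]) (↤-≢ {e} v≢x))
                     (trans (↤-≢ {id} (y∉ v (v≢x , o))) (sym (↤-≢ {e} v≢x)))

  private
    module CsubBinder {m : ℕ} {s : Subst} {e : Var → Var} {x : Var} (φ : Formula)
      (s-e : ∀ v → v ≢ x × Free v φ → s v ≡ var (e v) × e v < m) where
      step : ∀ v → Free v φ →
        (s [ x ↦ var m ]) v ≡ var ((e [ x ↤ m ]) v) × (e [ x ↤ m ]) v < suc m
      step v o with v ≟ x
      ... | yes refl = trans (if-≡ {x = v} refl) (cong var (sym (↤-≡ e v))) ,
                       subst (_< suc m) (sym (↤-≡ e v)) ≤-refl
      ... | no v≢x = let p , q = s-e v (v≢x , o) in
                     trans (if-≢ v≢x) (trans p (cong var (sym (↤-≢ {e} v≢x)))) ,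
                     subst (_< suc m) (sym (↤-≢ {e} v≢x)) (m<n⇒m<1+n q)

      notBound : ∀ v → v ≢ x × Free v φ → e v ≢ m
      notBound v o eq = <-irrefl eq (proj₂ (s-e v o))

  -- All values of `e` stay below the next bound name `m`, so none is captured. Thus the renamed
  -- copies of `δ f` inside `Def` are instances of `δ f`.
  Inst-csub : ∀ {m s e} φ → (∀ v → Free v φ → s v ≡ var (e v) × e v < m) → Inst e φ (csub m s φ)
  Inst-csub ⊥ᶠ h = i-⊥
  Inst-csub ⊤ᶠ h = i-⊤
  Inst-csub (s ≈ᶠ t) h = i-≈ (substT-cong s λ v → proj₁ ∘ h v ∘ inj₁) (substT-cong t λ v → proj₁ ∘ h v ∘ inj₂)
  Inst-csub (rel R ts) h = i-rel (substTs-cong ts λ v → proj₁ ∘ h v)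
  Inst-csub (¬ᶠ φ) h = i-¬ (Inst-csub φ h)
  Inst-csub (φ ∧ᶠ ψ) h = i-∧ (Inst-csub φ λ v → h v ∘ inj₁) (Inst-csub ψ λ v → h v ∘ inj₂)
  Inst-csub (φ ∨ᶠ ψ) h = i-∨ (Inst-csub φ λ v → h v ∘ inj₁) (Inst-csub ψ λ v → h v ∘ inj₂)
  Inst-csub {s = s} {e} (∀ᶠ x φ) h = i-∀ (Inst-csub φ step) notBound
    where open CsubBinder {s = s} {e} φ h
  Inst-csub {s = s} {e} (∃ᶠ x φ) h = i-∃ (Inst-csub φ step) notBound
    where open CsubBinder {s = s} {e} φ h

-- The tableau calculus: items, rules and refutations.

module Tableau (S : Signature) (Δ : Syntax.IsDefFormulas S) where
  open Syntax S
  open IsDefFormulas Δ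
  open Instances S

  -- Natural numbers serve as parameters: terms inside items have parameters as their variables,
  -- and an environment assigns parameters to the free variables of a formula. The variables of
  -- the original formulas become the even parameters, so that the odd ones are fresh.
  Env : Set
  Env = List (Var × ℕ)

  ⟪_⟫ : Env → Var → ℕ
  ⟪ [] ⟫ v = v + v
  ⟪ (x , p) ∷ e ⟫ = ⟪ e ⟫ [ x ↤ p ]

  infixl 8 _∙_
  _∙_ : Term → Env → Term
  t ∙ e = substT (var ∘ ⟪ e ⟫) t

  -- `eqn t t` doubles as definedness of `t`. `atm` carries a tuple of parameters instead of terms,
  -- so that relations of the model can be read off from it.
  data Item : Set where
    clo : TV → Formula → Env → Item
    eqn : Term → Term → Item
    und : Term → Item
    atm : TV → (R : Rel) → Vec ℕ (relAr R) → Item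

  infix 4 _≟ᵗ_
  _≟ᵗ_ : (a b : TV) → Dec (a ≡ b)
  𝐅 ≟ᵗ 𝐅 = yes refl
  𝐅 ≟ᵗ 𝐔 = no λ ()
  𝐅 ≟ᵗ 𝐓 = no λ ()
  𝐔 ≟ᵗ 𝐅 = no λ ()
  𝐔 ≟ᵗ 𝐔 = yes refl
  𝐔 ≟ᵗ 𝐓 = no λ ()
  𝐓 ≟ᵗ 𝐅 = no λ ()
  𝐓 ≟ᵗ 𝐔 = no λ ()
  𝐓 ≟ᵗ 𝐓 = yes refl

  allTV : List TV
  allTV = 𝐅 ∷ 𝐔 ∷ 𝐓 ∷ []

  ∈-allTV : ∀ a → a ∈ allTV
  ∈-allTV 𝐅 = here refl
  ∈-allTV 𝐔 = there (here refl)
  ∈-allTV 𝐓 = there (there (here refl))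

  abstract
    -- Abstract, so that the branches of a connective rule remain a `map` over an opaque list and
    -- are reached through membership alone.
    preimage₂ : (TV → TV → TV) → TV → List (TV × TV)
    preimage₂ _·_ v = filter (λ (a , b) → (a · b) ≟ᵗ v) (cartesianProduct allTV allTV)

    ∈-preimage₂⁺ : ∀ _·_ {v} a b → (a · b) ≡ v → (a , b) ∈ preimage₂ _·_ v
    ∈-preimage₂⁺ _·_ {v} a b eq =
      ∈-filter⁺ (λ (a , b) → (a · b) ≟ᵗ v) (∈-cartesianProduct⁺ (∈-allTV a) (∈-allTV b)) eq

    ∈-preimage₂⁻ : ∀ _·_ {v} a b → (a , b) ∈ preimage₂ _·_ v → (a · b) ≡ v
    ∈-preimage₂⁻ _·_ {v} a b ab∈ =
      proj₂ (∈-filter⁻ (λ (a , b) → (a · b) ≟ᵗ v) {xs = cartesianProduct allTV allTV} ab∈)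

    -- The signs that an instance may take: for `minᵗ` the values at least `v`, for `maxᵗ` those at
    -- most `v`.
    fixers : (TV → TV → TV) → TV → List TV
    fixers _·_ v = filter (λ a → (v · a) ≟ᵗ v) allTV

    ∈-fixers⁺ : ∀ _·_ {v} a → (v · a) ≡ v → a ∈ fixers _·_ v
    ∈-fixers⁺ _·_ {v} a eq = ∈-filter⁺ (λ a → (v · a) ≟ᵗ v) (∈-allTV a) eq

    ∈-fixers⁻ : ∀ _·_ {v} a → a ∈ fixers _·_ v → (v · a) ≡ v
    ∈-fixers⁻ _·_ {v} a a∈ = proj₂ (∈-filter⁻ (λ a → (v · a) ≟ᵗ v) {xs = allTV} a∈)

  Represents : ∀ {n} → Env → Vec ℕ n → Set
  Represents {n} e ps = ∀ (i : Fin n) → ⟪ e ⟫ (toℕ i) ≡ lookup ps i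

  vars : ∀ {n} → Vec ℕ n → Vec Term n
  vars = Vec.map var

  -- The first index lists the items that must be present, the second the alternative extensions; a
  -- rule without alternatives closes the branch.
  data Rule : List Item → List (List Item) → Set where
    r-⊥ : ∀ {v e} → v ≢ 𝐅 → Rule (clo v ⊥ᶠ e ∷ []) []
    r-⊤ : ∀ {v e} → v ≢ 𝐓 → Rule (clo v ⊤ᶠ e ∷ []) []
    r-≈T : ∀ {s t e} → Rule (clo 𝐓 (s ≈ᶠ t) e ∷ []) ((eqn (s ∙ e) (t ∙ e) ∷ []) ∷ [])
    r-≈F : ∀ {s t e} → Rule (clo 𝐅 (s ≈ᶠ t) e ∷ eqn (s ∙ e) (t ∙ e) ∷ []) []
    r-≈U : ∀ {s t e} → Rule (clo 𝐔 (s ≈ᶠ t) e ∷ []) ((und (s ∙ e) ∷ []) ∷ (und (t ∙ e) ∷ []) ∷ [])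
    r-≈ˡ : ∀ {v s t e} → v ≢ 𝐔 → Rule (clo v (s ≈ᶠ t) e ∷ und (s ∙ e) ∷ []) []
    r-≈ʳ : ∀ {v s t e} → v ≢ 𝐔 → Rule (clo v (s ≈ᶠ t) e ∷ und (t ∙ e) ∷ []) []
    r-relU : ∀ {R ts e} → Rule (clo 𝐔 (rel R ts) e ∷ [])
      (map (λ i → und (lookup ts i ∙ e) ∷ []) (allFin (relAr R)))
    r-rel-arg : ∀ {v R ts e} i → v ≢ 𝐔 → Rule (clo v (rel R ts) e ∷ und (lookup ts i ∙ e) ∷ []) []
    r-rel : ∀ {v R ts e ds} → v ≢ 𝐔 →
      Rule (clo v (rel R ts) e ∷ map (λ i → eqn (lookup ts i ∙ e) (var (lookup ds i))) (allFin (relAr R)))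
           ((atm v R ds ∷ []) ∷ [])
    r-atm : ∀ {v v' R ds} → v ≢ v' → Rule (atm v R ds ∷ atm v' R ds ∷ []) []
    r-¬ : ∀ {v φ e} → Rule (clo v (¬ᶠ φ) e ∷ []) ((clo (negᵗ v) φ e ∷ []) ∷ [])
    r-∧ : ∀ {v φ ψ e} → Rule (clo v (φ ∧ᶠ ψ) e ∷ [])
      (map (λ (a , b) → clo a φ e ∷ clo b ψ e ∷ []) (preimage₂ minᵗ v))
    r-∨ : ∀ {v φ ψ e} → Rule (clo v (φ ∨ᶠ ψ) e ∷ [])
      (map (λ (a , b) → clo a φ e ∷ clo b ψ e ∷ []) (preimage₂ maxᵗ v))
    r-var : ∀ {p} → Rule [] ((eqn (var p) (var p) ∷ []) ∷ [])
    r-con : ∀ {c} → Rule [] ((eqn (con c) (con c) ∷ []) ∷ [])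
    r-sym : ∀ {s t} → Rule (eqn s t ∷ []) ((eqn t s ∷ []) ∷ [])
    r-trans : ∀ {s t u} → Rule (eqn s t ∷ eqn t u ∷ []) ((eqn s u ∷ []) ∷ [])
    r-decide : ∀ {t} → Rule [] ((eqn t t ∷ []) ∷ (und t ∷ []) ∷ [])
    r-und : ∀ {t u} → Rule (eqn t u ∷ und t ∷ []) []
    r-arg : ∀ {f ts u} i → Rule (eqn (app f ts) u ∷ und (lookup ts i) ∷ []) []
    r-cong : ∀ {f ts us v} →
      Rule (eqn (app f ts) v ∷ map (λ i → eqn (lookup ts i) (lookup us i)) (allFin (funAr f)))
           ((eqn (app f us) v ∷ []) ∷ [])
    r-δT : ∀ {f ps e u} → Represents e ps → Rule (eqn (app f (vars ps)) u ∷ []) ((clo 𝐓 (δ f) e ∷ []) ∷ [])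
    r-δ¬ : ∀ {f ps e} → Represents e ps →
      Rule (und (app f (vars ps)) ∷ []) ((clo 𝐅 (δ f) e ∷ []) ∷ (clo 𝐔 (δ f) e ∷ []) ∷ [])

  -- The branches supplying a fresh parameter p: a value for a defined term; for a quantified
  -- formula either (index zero) a parameter attaining its truth value or (index suc q) a name
  -- for q. Since instances are taken at fresh names only, no capture can occur.
  witnesses : Item → ℕ → ℕ → List (List Item)
  witnesses (eqn t u) _ p = (eqn t (var p) ∷ []) ∷ []
  witnesses (clo v (∀ᶠ x φ) e) zero p = (clo v φ ((x , p) ∷ e) ∷ []) ∷ []
  witnesses (clo v (∀ᶠ x φ) e) (suc q) p =
    map (λ a → eqn (var q) (var p) ∷ clo a φ ((x , p) ∷ e) ∷ []) (fixers minᵗ v)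
  witnesses (clo v (∃ᶠ x φ) e) zero p = (clo v φ ((x , p) ∷ e) ∷ []) ∷ []
  witnesses (clo v (∃ᶠ x φ) e) (suc q) p =
    map (λ a → eqn (var q) (var p) ∷ clo a φ ((x , p) ∷ e) ∷ []) (fixers maxᵗ v)
  witnesses _ _ p = [] ∷ []

  boundE : Env → ℕ
  boundE [] = 0
  boundE ((_ , p) ∷ e) = p ⊔ boundE e

  -- The formula of a `clo` contributes nothing: variables outside its environment denote even
  -- parameters, while fresh parameters are odd.
  bound : Item → ℕ
  bound (clo v φ e) = boundE e
  bound (eqn s t) = mvT s ⊔ mvT t
  bound (und t) = mvT t
  bound (atm v R ds) = mvTs (vars ds)

  Odd : ℕ → Set
  Odd p = ∀ i → p ≢ i + i

  Fresh : ℕ → ℕ → List Item → Set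
  Fresh p q L = Odd p × q < p × All (λ I → bound I < p) L

  -- `witness` asks for refutations at every fresh `p`. A larger list has fewer fresh parameters, so
  -- weakening needs no renaming of parameters; soundness chooses a single `p`, and irrefutability
  -- yields some `p` with an irrefutable branch.
  data Refutable (Γ : Formula → Set) (L : List Item) : Set where
    premise : ∀ {φ} → Γ φ → Refutable Γ (clo 𝐓 φ [] ∷ L) → Refutable Γ L
    apply : ∀ {P Bs} → Rule P Bs → All (_∈ L) P → All (λ B → Refutable Γ (B ++ L)) Bs → Refutable Γ L
    witness : ∀ {I} q → I ∈ L → (∀ p → Fresh p q L → All (λ B → Refutable Γ (B ++ L)) (witnesses I q p)) →
      Refutable Γ L

  ++-mono : ∀ {L L' : List Item} B → L ⊆ L' → B ++ L ⊆ B ++ L'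
  ++-mono B sub p = [ ∈-++⁺ˡ , ∈-++⁺ʳ B ∘ sub ] (∈-++⁻ B p)

  mutual
    refutable-mono : ∀ {Γ L L'} → L ⊆ L' → Refutable Γ L → Refutable Γ L'
    refutable-mono sub (premise γ r) = premise γ (refutable-mono (++-mono (_ ∷ []) sub) r)
    refutable-mono sub (apply rule ps rs) = apply rule (All.map sub ps) (refutable-monos sub rs)
    refutable-mono sub (witness q I∈L rs) = witness q (sub I∈L)
      λ p (odd , q<p , L<p) → refutable-monos sub (rs p (odd , q<p , All.anti-mono sub L<p))

    refutable-monos : ∀ {Γ L L' Bs} → L ⊆ L' → All (λ B → Refutable Γ (B ++ L)) Bs →
      All (λ B → Refutable Γ (B ++ L')) Bs
    refutable-monos sub [] = []
    refutable-monos sub (_∷_ {B} r rs) = refutable-mono (++-mono B sub) r ∷ refutable-monos sub rs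

  freshParameter : ∀ q L → Σ ℕ λ p → Fresh p q L
  freshParameter q L = p , odd , s≤s (≤-trans (m≤m⊔n q _) (m≤m+n m m)) ,
    All.tabulate λ I∈L → s≤s (≤-trans (≤-trans (below L I∈L) (m≤n⊔m q _)) (m≤m+n m m))
    where
    maxBound : List Item → ℕ
    maxBound [] = 0
    maxBound (I ∷ L) = bound I ⊔ maxBound L
    below : ∀ {I} L → I ∈ L → bound I ≤ maxBound L
    below (J ∷ L) (here refl) = m≤m⊔n _ _
    below (J ∷ L) (there p) = ≤-trans (below L p) (m≤n⊔m (bound J) _)
    m p : ℕ
    m = q ⊔ maxBound L
    p = suc (m + m)
    odd : Odd p
    odd = odd≢even m

-- Translation of refutations into derivations.

module Soundness (S : Signature) (Δ : Syntax.IsDefFormulas S) where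
  open Syntax S
  open IsDefFormulas Δ
  open Logic S Δ
  open SyntaxLemmas S
  open DerivedRules S Δ
  open Instances S
  open Tableau S Δ

  infixl 8 _⋆_ _⋆s_
  _⋆_ : Term → (ℕ → Var) → Term
  t ⋆ θ = substT (var ∘ θ) t

  _⋆s_ : ∀ {n} → Vec Term n → (ℕ → Var) → Vec Term n
  ts ⋆s θ = substTs (var ∘ θ) ts

  lookup-substTs : ∀ {n σ} (ts : Vec Term n) i → lookup (substTs σ ts) i ≡ substT σ (lookup ts i)
  lookup-substTs (t ∷ ts) zero = refl
  lookup-substTs (t ∷ ts) (suc i) = lookup-substTs ts i

  -- An item is read in two steps: environments send variables to parameters, and `θ` sends
  -- parameters to variables of the calculus.
  Holds : (ℕ → Var) → List Formula → Item → Set₁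
  Holds θ C (clo v φ e) = Σ Formula λ χ → Inst (θ ∘ ⟪ e ⟫) φ χ × (C ⊩ signed v χ)
  Holds θ C (eqn s t) = C ⊩ s ⋆ θ ≈ᶠ t ⋆ θ
  Holds θ C (und t) = C ⊩ Undefined (t ⋆ θ)
  Holds θ C (atm v R ds) = C ⊩ signed v (rel R (vars ds ⋆s θ))

  Holds-wk : ∀ {θ C C'} I → C ⊆ C' → Holds θ C I → Holds θ C' I
  Holds-wk (clo v φ e) sub (χ , i , d) = χ , i , wk sub d
  Holds-wk (eqn s t) sub d = wk sub d
  Holds-wk (und t) sub d = wk sub d
  Holds-wk (atm v R ds) sub d = wk sub d

  env-fresh : ∀ {p} e v → Odd p → boundE e < p → ⟪ e ⟫ v ≢ p
  env-fresh [] v odd e<p eq = odd v (sym eq)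
  env-fresh ((x , q) ∷ e) v odd e<p eq with v ≟ x
  ... | yes refl = <⇒≢ (≤-<-trans (m≤m⊔n q (boundE e)) e<p) (trans (sym (↤-≡ ⟪ e ⟫ v)) eq)
  ... | no v≢x = env-fresh e v odd (≤-<-trans (m≤n⊔m q (boundE e)) e<p)
                   (trans (sym (↤-≢ {⟪ e ⟫} v≢x)) eq)

  ⋆-fresh : ∀ {θ p z} t → mvT t < p → t ⋆ (θ [ p ↤ z ]) ≡ t ⋆ θ
  ⋆-fresh {θ} t t<p = substT-cong t λ v o → cong var (↤-≢ {θ} λ { refl → fresh-occT t t<p o })

  ⋆s-fresh : ∀ {n θ p z} (ts : Vec Term n) → mvTs ts < p → ts ⋆s (θ [ p ↤ z ]) ≡ ts ⋆s θ
  ⋆s-fresh {θ = θ} ts ts<p =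
    substTs-cong ts λ v o → cong var (↤-≢ {θ} λ { refl → <⇒≱ ts<p (occ≤mvTs ts o) })

  Holds-fresh : ∀ {θ C p z} I → Odd p → bound I < p → Holds θ C I → Holds (θ [ p ↤ z ]) C I
  Holds-fresh {θ} (clo v φ e) odd I<p (χ , i , d) =
    χ , Inst-cong (λ w _ → sym (↤-≢ {θ} (env-fresh e w odd I<p))) i , d
  Holds-fresh {C = C} (eqn s t) odd I<p d = subst (C ⊩_) (sym (cong₂ _≈ᶠ_
    (⋆-fresh s (≤-<-trans (m≤m⊔n _ _) I<p)) (⋆-fresh t (≤-<-trans (m≤n⊔m (mvT s) _) I<p)))) d
  Holds-fresh {C = C} (und t) odd I<p d = subst (λ u → C ⊩ Undefined u) (sym (⋆-fresh t I<p)) d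
  Holds-fresh {C = C} (atm v R ds) odd I<p d =
    subst (λ us → C ⊩ signed v (rel R us)) (sym (⋆s-fresh (vars ds) I<p)) d

  private
    ∙⋆ : ∀ {θ} t e → (t ∙ e) ⋆ θ ≡ substT (var ∘ θ ∘ ⟪ e ⟫) t
    ∙⋆ t e = substT-∘ t

    lookup-∙⋆ : ∀ {n θ} (ts : Vec Term n) i e →
      (lookup ts i ∙ e) ⋆ θ ≡ lookup (substTs (var ∘ θ ∘ ⟪ e ⟫) ts) i
    lookup-∙⋆ ts i e = trans (∙⋆ (lookup ts i) e) (sym (lookup-substTs ts i))

    signed-Def : ∀ {C φ} v → v ≢ 𝐔 → C ⊩ signed v φ → C ⊩ Def φ
    signed-Def 𝐅 v≢U d = def d
    signed-Def 𝐔 v≢U d = ⊥-elim (v≢U refl)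
    signed-Def 𝐓 v≢U d = def d

    Inst-δ : ∀ {θ e} f (ps : Vec ℕ (funAr f)) → Represents e ps →
      Inst (θ ∘ ⟪ e ⟫) (δ f) (instδ f (vars ps ⋆s θ))
    Inst-δ {θ} {e} f ps rep = Inst-csub (δ f) λ v o → agree v (δ-free f v o)
      where
      ts : Vec Term (funAr f)
      ts = vars ps ⋆s θ
      lookup-ts : ∀ i → lookup ts i ≡ var (θ (lookup ps i))
      lookup-ts i = trans (lookup-substTs (vars ps) i) (cong (substT (var ∘ θ)) (lookup-map i var ps))
      mv-lookup : ∀ {n} (us : Vec Term n) i → mvT (lookup us i) ≤ mvTs us
      mv-lookup (u ∷ us) zero = m≤m⊔n _ _
      mv-lookup (u ∷ us) (suc i) = ≤-trans (mv-lookup us i) (m≤n⊔m (mvT u) _)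
      agree : ∀ v → v < funAr f →
        vecEnv ts v ≡ var (θ (⟪ e ⟫ v)) × θ (⟪ e ⟫ v) < suc (mvTs ts ⊔ mvF (δ f))
      agree v v<n with v <? funAr f
      ... | no v≮n = ⊥-elim (v≮n v<n)
      ... | yes v<n' = eq , s≤s (≤-trans (subst (λ u → mvT u ≤ mvTs ts) eq (mv-lookup ts (fromℕ< v<n')))
                               (m≤m⊔n (mvTs ts) _))
        where
        eq : lookup ts (fromℕ< v<n') ≡ var (θ (⟪ e ⟫ v))
        eq = trans (lookup-ts (fromℕ< v<n')) (cong (var ∘ θ)
          (trans (sym (rep (fromℕ< v<n'))) (cong ⟪ e ⟫ (toℕ-fromℕ< v<n'))))

    Def-vars : ∀ {C θ n} (ps : Vec ℕ n) i → C ⊩ DefT (lookup (vars ps ⋆s θ) i)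
    Def-vars {C} {θ} ps i = subst (λ t → C ⊩ DefT t)
      (sym (trans (lookup-substTs (vars ps) i) (cong (_⋆ θ) (lookup-map i var ps)))) ⊤i

  Refuted : (ℕ → Var) → List Formula → List Item → Set₁
  Refuted θ C B = ∀ {C'} → C ⊆ C' → All (Holds θ C') B → C' ⊩ ⊥ᶠ

  rule-sound : ∀ {P Bs θ C} → Rule P Bs → All (Holds θ C) P →
    (∀ {B} → B ∈ Bs → Refuted θ C B) → C ⊩ ⊥ᶠ
  rule-sound (r-⊥ {𝐅} v≢) hs k = ⊥-elim (v≢ refl)
  rule-sound (r-⊥ {𝐔} v≢) ((_ , i-⊥ , d) ∷ []) k = contra ⊤i d
  rule-sound (r-⊥ {𝐓} v≢) ((_ , i-⊥ , d) ∷ []) k = d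
  rule-sound (r-⊤ {𝐅} v≢) ((_ , i-⊤ , d) ∷ []) k = contra ⊤i d
  rule-sound (r-⊤ {𝐔} v≢) ((_ , i-⊤ , d) ∷ []) k = contra ⊤i d
  rule-sound (r-⊤ {𝐓} v≢) hs k = ⊥-elim (v≢ refl)
  rule-sound {C = C} (r-≈T {s} {t} {e}) ((_ , i-≈ refl refl , d) ∷ []) k =
    k (here refl) id (subst (C ⊩_) (sym (cong₂ _≈ᶠ_ (∙⋆ s e) (∙⋆ t e))) d ∷ [])
  rule-sound {C = C} (r-≈F {s} {t} {e}) ((_ , i-≈ refl refl , d) ∷ d' ∷ []) k =
    contra (subst (C ⊩_) (cong₂ _≈ᶠ_ (∙⋆ s e) (∙⋆ t e)) d') d
  rule-sound (r-≈U {s} {t} {e}) ((_ , i-≈ {s' = s'} {t'} refl refl , d) ∷ []) k =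
    Def-cases s'
      (Def-cases t' (contra (∧i (wk₁ hyp₀) hyp₀) (wk₁ (wk₁ d)))
        (k (there (here refl)) (there ∘ there)
          (subst (λ u → Undefined t' ∷ _ ⊩ Undefined u) (sym (∙⋆ t e)) hyp₀ ∷ [])))
      (k (here refl) there (subst (λ u → Undefined s' ∷ _ ⊩ Undefined u) (sym (∙⋆ s e)) hyp₀ ∷ []))
  rule-sound {C = C} (r-≈ˡ {v} {s} {t} {e} v≢) ((_ , i-≈ {s' = s'} {t'} refl refl , d) ∷ u ∷ []) k =
    Undefined-contra s' (∧e₁ (signed-Def v v≢ d)) (subst (λ t → C ⊩ Undefined t) (∙⋆ s e) u)
  rule-sound {C = C} (r-≈ʳ {v} {s} {t} {e} v≢) ((_ , i-≈ {s' = s'} {t'} refl refl , d) ∷ u ∷ []) k =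
    Undefined-contra t' (∧e₂ (signed-Def v v≢ d)) (subst (λ t → C ⊩ Undefined t) (∙⋆ t e) u)
  rule-sound {C = C} (r-relU {R} {ts} {e}) ((_ , i-rel {ts' = ts'} refl , d) ∷ []) k =
    Def-casesAll ts'
      (λ i → k (∈-map⁺ _ (∈-allFin i)) there
        (subst (λ u → Undefined (lookup ts' i) ∷ C ⊩ Undefined u) (sym (lookup-∙⋆ ts i e)) hyp₀ ∷ []))
      λ sub ds → contra (Def-rel R ts' ds) (wk sub d)
  rule-sound {C = C} (r-rel-arg {v} {R} {ts} {e} i v≢) ((_ , i-rel {ts' = ts'} refl , d) ∷ u ∷ []) k =
    Undefined-contra (lookup ts' i) (Def-rel-arg R ts' i (signed-Def v v≢ d))
      (subst (λ t → C ⊩ Undefined t) (lookup-∙⋆ ts i e) u)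
  rule-sound {θ = θ} {C} (r-rel {v} {R} {ts} {e} {ds} v≢) ((_ , i-rel {ts' = ts'} refl , d) ∷ eqs) k =
    k (here refl) id (rel-cong v ts' (vars ds ⋆s θ) v≢ (λ i →
      subst (C ⊩_) (cong₂ _≈ᶠ_ (lookup-∙⋆ ts i e) (sym (trans (lookup-substTs (vars ds) i)
        (cong (_⋆ θ) (lookup-map i var ds))))) (All.lookup eqs (∈-map⁺ _ (∈-allFin i)))) d ∷ [])
  rule-sound (r-atm {v} {v'} v≢v') (d ∷ d' ∷ []) k = exclusive v v' v≢v' d d'
  rule-sound (r-¬ {v}) ((_ , i-¬ i , d) ∷ []) k = k (here refl) id ((_ , i , signed-¬ v d) ∷ [])
  -- The branches contain only the pairs of signs with minimum `v`; for any other pair the derived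
  -- sign of the conjunction excludes `v`.
  rule-sound (r-∧ {v}) ((_ , i-∧ {χ = χ} {ξ} i j , d) ∷ []) k = exhaust χ λ a → exhaust ξ λ b →
    case minᵗ a b ≟ᵗ v of λ where
      (yes eq) → k (∈-map⁺ _ (∈-preimage₂⁺ minᵗ a b eq)) (there ∘ there)
        ((_ , i , wk₁ hyp₀) ∷ (_ , j , hyp₀) ∷ [])
      (no neq) → exclusive (minᵗ a b) v neq (signed-∧ a b (wk₁ hyp₀) hyp₀) (wk₁ (wk₁ d))
  rule-sound (r-∨ {v}) ((_ , i-∨ {χ = χ} {ξ} i j , d) ∷ []) k = exhaust χ λ a → exhaust ξ λ b →
    case maxᵗ a b ≟ᵗ v of λ where
      (yes eq) → k (∈-map⁺ _ (∈-preimage₂⁺ maxᵗ a b eq)) (there ∘ there)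
        ((_ , i , wk₁ hyp₀) ∷ (_ , j , hyp₀) ∷ [])
      (no neq) → exclusive (maxᵗ a b) v neq (signed-∨ a b (wk₁ hyp₀) hyp₀) (wk₁ (wk₁ d))
  rule-sound r-var hs k = k (here refl) id (≈-refl ⊤i ∷ [])
  rule-sound r-con hs k = k (here refl) id (≈-refl ⊤i ∷ [])
  rule-sound r-sym (d ∷ []) k = k (here refl) id (≈-sym d ∷ [])
  rule-sound r-trans (d ∷ d' ∷ []) k = k (here refl) id (≈-trans d d' ∷ [])
  rule-sound {θ = θ} (r-decide {t}) hs k = Def-cases (t ⋆ θ)
    (k (here refl) there (≈-refl hyp₀ ∷ [])) (k (there (here refl)) there (hyp₀ ∷ []))
  rule-sound {θ = θ} (r-und {t}) (d ∷ u ∷ []) k = Undefined-contra (t ⋆ θ) (≈-Def d) u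
  rule-sound {θ = θ} {C} (r-arg {f} {ts} i) (d ∷ u ∷ []) k =
    Undefined-contra (lookup (ts ⋆s θ) i) (Def-arg f (ts ⋆s θ) i (≈-Def d)) (subst (λ t → C ⊩ Undefined t) (sym (lookup-substTs ts i)) u)
  rule-sound {C = C} (r-cong {f} {ts} {us}) (d ∷ eqs) k = k (here refl) id (app-cong _ _ (λ i →
    subst (C ⊩_) (sym (cong₂ _≈ᶠ_ (lookup-substTs ts i) (lookup-substTs us i)))
      (All.lookup eqs (∈-map⁺ _ (∈-allFin i)))) d ∷ [])
  rule-sound {θ = θ} (r-δT {f} {ps} {e} rep) (d ∷ []) k =
    k (here refl) id ((_ , Inst-δ {e = e} f ps rep , Def-δ f (vars ps ⋆s θ) (≈-Def d)) ∷ [])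
  rule-sound {θ = θ} (r-δ¬ {f} {ps} {e} rep) (u ∷ []) k = exhaust (instδ f (vars ps ⋆s θ)) λ where
    𝐓 → Undefined-contra (app f (vars ps) ⋆ θ) (Def-app f (vars ps ⋆s θ) (Def-vars ps) hyp₀) (wk₁ u)
    𝐅 → k (here refl) there ((_ , Inst-δ {e = e} f ps rep , hyp₀) ∷ [])
    𝐔 → k (there (here refl)) there ((_ , Inst-δ {e = e} f ps rep , hyp₀) ∷ [])

  belowAll : ∀ C → Σ Var λ z → Below z C
  belowAll [] = 0 , []
  belowAll (φ ∷ C) = let z , C<z = belowAll C in suc (mvF φ ⊔ z) ,
    s≤s (m≤m⊔n _ _) ∷ All.map (λ χ<z → ≤-trans χ<z (≤-trans (m≤n⊔m (mvF φ) z) (n≤1+n _))) C<z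

  private
    Inst-witness : ∀ {θ e x y p z φ χ} → Odd p → boundE e < p →
      (∀ v → v ≢ x × Free v φ → θ (⟪ e ⟫ v) ≢ y) → ¬ Occ z χ →
      Inst ((θ ∘ ⟪ e ⟫) [ x ↤ y ]) φ χ →
      Inst ((θ [ p ↤ z ]) ∘ ⟪ (x , p) ∷ e ⟫) φ (χ ⟨ y ≔ var z ⟩)
    Inst-witness {θ} {e} {x} {y} {p} {z} {φ} odd e<p y∉ z∉ i =
      Inst-cong agree (Inst-fresh {θ ∘ ⟪ e ⟫} y∉ z∉ i)
      where
      agree : ∀ v → Free v φ → ((θ ∘ ⟪ e ⟫) [ x ↤ z ]) v ≡ (θ [ p ↤ z ]) (⟪ (x , p) ∷ e ⟫ v)
      agree v o with v ≟ x
      ... | yes refl = trans (↤-≡ (θ ∘ ⟪ e ⟫) v)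
        (sym (trans (cong (θ [ p ↤ z ]) (↤-≡ ⟪ e ⟫ v)) (↤-≡ θ p)))
      ... | no v≢x = trans (↤-≢ {θ ∘ ⟪ e ⟫} v≢x)
        (sym (trans (cong (θ [ p ↤ z ]) (↤-≢ {⟪ e ⟫} v≢x)) (↤-≢ {θ} (env-fresh e v odd e<p))))

    named : ∀ {θ C q p z} → q < p → C ⊩ var (θ q) ≈ᶠ var z → Holds (θ [ p ↤ z ]) C (eqn (var q) (var p))
    named {θ} {C} {q} {p} q<p d = subst (C ⊩_) (sym (cong₂ (λ a b → var a ≈ᶠ var b)
      (↤-≢ {θ} (<⇒≢ q<p)) (↤-≡ θ p))) d

  witness-sound : ∀ {θ C} I q p → Odd p → q < p → bound I < p → Holds θ C I →
    (∀ z {B} → B ∈ witnesses I q p → Refuted (θ [ p ↤ z ]) C B) → C ⊩ ⊥ᶠ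
  -- The extra equation serves by its size alone: it forces `z` above `suc (mvT (t ⋆ θ))`, as `name`
  -- requires.
  witness-sound {θ} {C} (eqn t u) q p odd q<p I<p d k with belowAll (var (suc (mvT (t ⋆ θ))) ≈ᶠ var 0 ∷ C)
  ... | z , t<z ∷ C<z = name (t ⋆ θ) z C<z t<z' (≈-Def d) (k z (here refl) there
        (subst (t ⋆ θ ≈ᶠ var z ∷ C ⊩_) (sym (cong₂ _≈ᶠ_ (⋆-fresh {θ} t (≤-<-trans (m≤m⊔n _ _) I<p)) (cong var (↤-≡ θ p)))) hyp₀ ∷ []))
    where
    t<z' : suc (mvT (t ⋆ θ)) < z
    t<z' = ≤-<-trans (m≤m⊔n _ 0) t<z
  witness-sound {θ} {C} (clo v (∀ᶠ x φ) e) zero p odd q<p I<p (_ , i-∀ {y = y} {χ = χ} i y∉ , d) k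
    with belowAll (Def (∀ᶠ y χ) ∷ C)
  ... | z , D<z ∷ C<z = F.attained-∀ v d
        (k z (here refl) there ((_ , Inst-witness {θ} {e} odd I<p y∉ (fresh-occ (∀ᶠ y χ) F.φ<z ∘ inj₂) i , hyp₀) ∷ []))
    where module F = FreshInstance y z χ C<z D<z
  witness-sound {θ} {C} (clo v (∃ᶠ x φ) e) zero p odd q<p I<p (_ , i-∃ {y = y} {χ = χ} i y∉ , d) k
    with belowAll (Def (∃ᶠ y χ) ∷ C)
  ... | z , D<z ∷ C<z = F.attained-∃ v d
        (k z (here refl) there ((_ , Inst-witness {θ} {e} odd I<p y∉ (fresh-occ (∀ᶠ y χ) F.φ<z ∘ inj₂) i , hyp₀) ∷ []))
    where module F = FreshInstance y z χ C<z D<z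
  witness-sound {θ} {C} (clo v (∀ᶠ x φ) e) (suc q) p odd q<p I<p (_ , i-∀ {y = y} {χ = χ} i y∉ , d) k
    with belowAll (var (suc (θ q)) ≈ᶠ var 0 ∷ Def (∀ᶠ y χ) ∷ C)
  ... | z , q<z ∷ D<z ∷ C<z = name (var (θ q)) z C<z (≤-<-trans (m≤m⊔n _ 0) q<z) ⊤i
        (exhaust F.φz λ a → case minᵗ v a ≟ᵗ v of λ where
          (yes eq) → k z (∈-map⁺ _ (∈-fixers⁺ minᵗ a eq)) (there ∘ there)
            (named {θ} (<-trans ≤-refl q<p) (wk₁ hyp₀) ∷
             (_ , Inst-witness {θ} {e} odd I<p y∉ (fresh-occ (∀ᶠ y χ) F.φ<z ∘ inj₂) i , hyp₀) ∷ [])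
          (no neq) → contradictory-∀ v a F.ff neq (wk₁ (wk₁ d)) hyp₀)
    where module F = FreshInstance y z χ C<z D<z
  witness-sound {θ} {C} (clo v (∃ᶠ x φ) e) (suc q) p odd q<p I<p (_ , i-∃ {y = y} {χ = χ} i y∉ , d) k
    with belowAll (var (suc (θ q)) ≈ᶠ var 0 ∷ Def (∃ᶠ y χ) ∷ C)
  ... | z , q<z ∷ D<z ∷ C<z = name (var (θ q)) z C<z (≤-<-trans (m≤m⊔n _ 0) q<z) ⊤i
        (exhaust F.φz λ a → case maxᵗ v a ≟ᵗ v of λ where
          (yes eq) → k z (∈-map⁺ _ (∈-fixers⁺ maxᵗ a eq)) (there ∘ there)
            (named {θ} (<-trans ≤-refl q<p) (wk₁ hyp₀) ∷
             (_ , Inst-witness {θ} {e} odd I<p y∉ (fresh-occ (∀ᶠ y χ) F.φ<z ∘ inj₂) i , hyp₀) ∷ [])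
          (no neq) → contradictory-∃ v a F.ff neq (wk₁ (wk₁ d)) hyp₀)
    where module F = FreshInstance y z χ C<z D<z
  -- The remaining items have one branch, and it is empty, so its refutation is already one of `C`.
  witness-sound (clo v ⊥ᶠ e) q p odd q<p I<p h k = k 0 (here refl) id []
  witness-sound (clo v ⊤ᶠ e) q p odd q<p I<p h k = k 0 (here refl) id []
  witness-sound (clo v (_ ≈ᶠ _) e) q p odd q<p I<p h k = k 0 (here refl) id []
  witness-sound (clo v (rel R ts) e) q p odd q<p I<p h k = k 0 (here refl) id []
  witness-sound (clo v (¬ᶠ φ) e) q p odd q<p I<p h k = k 0 (here refl) id []
  witness-sound (clo v (φ ∧ᶠ ψ) e) q p odd q<p I<p h k = k 0 (here refl) id []
  witness-sound (clo v (φ ∨ᶠ ψ) e) q p odd q<p I<p h k = k 0 (here refl) id []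
  witness-sound (und t) q p odd q<p I<p h k = k 0 (here refl) id []
  witness-sound (atm v R ds) q p odd q<p I<p h k = k 0 (here refl) id []

  -- θ must send the parameter of each variable of the premises back to that variable.
  Base : (ℕ → Var) → Set
  Base θ = ∀ i → θ (i + i) ≡ i

  Base-fresh : ∀ {θ p z} → Odd p → Base θ → Base (θ [ p ↤ z ])
  Base-fresh {θ} odd base i = trans (↤-≢ {θ} (odd i ∘ sym)) (base i)

  mutual
    -- The finite list of premises is extracted before `θ` and the context are chosen. Hence each
    -- subderivation can be replayed in extended contexts and with `θ` changed at a fresh parameter.
    refutable-sound : ∀ {Γ L} → Refutable Γ L → Σ (List Formula) λ G → All Γ G ×
      (∀ θ C → Base θ → All (Holds θ C) L → All (C ⊩_) G → C ⊩ ⊥ᶠ)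
    refutable-sound (premise {φ} γ r) =
      let G , Γ-G , k = refutable-sound r in φ ∷ G , γ ∷ Γ-G , λ where
        θ C base hs (d ∷ ds) → k θ C base ((φ , Inst-id φ (λ v _ → base v) , d) ∷ hs) ds
    refutable-sound (apply rule ps rs) =
      let G , Γ-G , k = refutables-sound rs in G , Γ-G , λ θ C base hs ds →
        rule-sound rule (All.map (All.lookup hs) ps) λ B∈Bs sub bs →
          k θ _ base (All.map (λ {I} → Holds-wk I sub) hs) (All.map (wk sub) ds) B∈Bs bs
    refutable-sound {L = L} (witness {I} q I∈L rs) =
      let p , fresh@(odd , q<p , L<p) = freshParameter q L
          G , Γ-G , k = refutables-sound (rs p fresh) in
      G , Γ-G , λ θ C base hs ds →
        witness-sound I q p odd q<p (All.lookup L<p I∈L) (All.lookup hs I∈L) λ z B∈Bs sub bs →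
          k (θ [ p ↤ z ]) _ (Base-fresh {θ} odd base)
            (All.zipWith (λ {J} (J<p , h) → Holds-wk J sub (Holds-fresh J odd J<p h)) (L<p , hs))
            (All.map (wk sub) ds) B∈Bs bs

    refutables-sound : ∀ {Γ L Bs} → All (λ B → Refutable Γ (B ++ L)) Bs → Σ (List Formula) λ G → All Γ G ×
      (∀ θ C → Base θ → All (Holds θ C) L → All (C ⊩_) G →
        ∀ {B} → B ∈ Bs → All (Holds θ C) B → C ⊩ ⊥ᶠ)
    refutables-sound [] = [] , [] , λ _ _ _ _ _ ()
    refutables-sound (r ∷ rs) =
      let G , Γ-G , k = refutable-sound r
          G' , Γ-G' , k' = refutables-sound rs in
      G ++ G' , All.++⁺ Γ-G Γ-G' , λ where
        θ C base hs ds (here refl) bs → k θ C base (All.++⁺ bs hs) (All.++⁻ˡ G ds)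
        θ C base hs ds (there B∈Bs) bs → k' θ C base hs (All.++⁻ʳ G ds) B∈Bs bs

-- Countability of items.

double-injective : ∀ {m n} → m + m ≡ n + n → m ≡ n
double-injective {m} {n} eq = trans (n≡⌊n+n/2⌋ m) (trans (cong ⌊_/2⌋ eq) (sym (n≡⌊n+n/2⌋ n)))

-- 2 ^ m * (2 * n + 1)
pair : ℕ → ℕ → ℕ
pair zero n = suc (n + n)
pair (suc m) n = pair m n + pair m n

pair-injective : ∀ m {n} m' {n'} → pair m n ≡ pair m' n' → m ≡ m' × n ≡ n'
pair-injective zero zero eq = refl , double-injective (suc-injective eq)
pair-injective zero {n} (suc m') {n'} eq = ⊥-elim (odd≢even n (pair m' n') eq)
pair-injective (suc m) {n} zero {n'} eq = ⊥-elim (odd≢even n' (pair m n) (sym eq))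
pair-injective (suc m) (suc m') eq =
  let p , q = pair-injective m m' (double-injective eq) in cong suc p , q

data Tree : Set where
  leaf : ℕ → Tree
  node : Tree → Tree → Tree

Tree-countable : Countable Tree
Tree-countable = encode , injective
  where
  encode : Tree → ℕ
  encode (leaf n) = pair n 0
  encode (node s t) = pair (encode s) (suc (encode t))
  injective : ∀ s t → encode s ≡ encode t → s ≡ t
  injective (leaf m) (leaf n) eq = cong leaf (proj₁ (pair-injective m n eq))
  injective (leaf m) (node t t') eq = case proj₂ (pair-injective m (encode t) eq) of λ ()
  injective (node s s') (leaf n) eq = case proj₂ (pair-injective (encode s) n eq) of λ ()
  injective (node s s') (node t t') eq =
    let p , q = pair-injective (encode s) (encode t) eq in
    cong₂ node (injective s t p) (injective s' t' (suc-injective q))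

module ItemCodes (S : Signature) (Δ : Syntax.IsDefFormulas S) where
  open Syntax S
  open Tableau S Δ

  -- Codes are given as relations: matching two codings of the same tree leaves only the
  -- diagonal cases.
  mutual
    data CodeT : Term → Tree → Set where
      c-var : ∀ {x} → CodeT (var x) (node (leaf 0) (leaf x))
      c-con : ∀ {c n} → proj₁ Const-countable c ≡ n → CodeT (con c) (node (leaf 1) (leaf n))
      c-app : ∀ {f ts n a} → proj₁ Fun-countable f ≡ n → CodeTs ts a →
        CodeT (app f ts) (node (leaf 2) (node (leaf n) a))

    data CodeTs : ∀ {n} → Vec Term n → Tree → Set where
      c-[] : CodeTs [] (leaf 0)
      c-∷ : ∀ {n t} {ts : Vec Term n} {a b} → CodeT t a → CodeTs ts b → CodeTs (t ∷ ts) (node a b)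

  data CodeF : Formula → Tree → Set where
    c-⊥ : CodeF ⊥ᶠ (node (leaf 0) (leaf 0))
    c-⊤ : CodeF ⊤ᶠ (node (leaf 1) (leaf 0))
    c-≈ : ∀ {s t a b} → CodeT s a → CodeT t b → CodeF (s ≈ᶠ t) (node (leaf 2) (node a b))
    c-rel : ∀ {R ts n a} → proj₁ Rel-countable R ≡ n → CodeTs ts a →
      CodeF (rel R ts) (node (leaf 3) (node (leaf n) a))
    c-¬ : ∀ {φ a} → CodeF φ a → CodeF (¬ᶠ φ) (node (leaf 4) a)
    c-∧ : ∀ {φ ψ a b} → CodeF φ a → CodeF ψ b → CodeF (φ ∧ᶠ ψ) (node (leaf 5) (node a b))
    c-∨ : ∀ {φ ψ a b} → CodeF φ a → CodeF ψ b → CodeF (φ ∨ᶠ ψ) (node (leaf 6) (node a b))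
    c-∀ : ∀ {x φ a} → CodeF φ a → CodeF (∀ᶠ x φ) (node (leaf 7) (node (leaf x) a))
    c-∃ : ∀ {x φ a} → CodeF φ a → CodeF (∃ᶠ x φ) (node (leaf 8) (node (leaf x) a))

  data CodeV : TV → Tree → Set where
    c-𝐅 : CodeV 𝐅 (leaf 0)
    c-𝐔 : CodeV 𝐔 (leaf 1)
    c-𝐓 : CodeV 𝐓 (leaf 2)

  data CodeE : Env → Tree → Set where
    c-[] : CodeE [] (leaf 0)
    c-∷ : ∀ {x p e a} → CodeE e a → CodeE ((x , p) ∷ e) (node (leaf x) (node (leaf p) a))

  data CodeI : Item → Tree → Set where
    c-clo : ∀ {v φ e a b c} → CodeV v a → CodeF φ b → CodeE e c →
      CodeI (clo v φ e) (node (leaf 0) (node a (node b c)))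
    c-eqn : ∀ {s t a b} → CodeT s a → CodeT t b → CodeI (eqn s t) (node (leaf 1) (node a b))
    c-und : ∀ {t a} → CodeT t a → CodeI (und t) (node (leaf 2) a)
    c-atm : ∀ {v R ds a n b} → CodeV v a → proj₁ Rel-countable R ≡ n → CodeTs (vars ds) b →
      CodeI (atm v R ds) (node (leaf 3) (node a (node (leaf n) b)))

  mutual
    codeT : ∀ t → Σ Tree (CodeT t)
    codeT (var x) = _ , c-var
    codeT (con c) = _ , c-con refl
    codeT (app f ts) = _ , c-app refl (proj₂ (codeTs ts))

    codeTs : ∀ {n} (ts : Vec Term n) → Σ Tree (CodeTs ts)
    codeTs [] = _ , c-[]
    codeTs (t ∷ ts) = _ , c-∷ (proj₂ (codeT t)) (proj₂ (codeTs ts))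

  codeF : ∀ φ → Σ Tree (CodeF φ)
  codeF ⊥ᶠ = _ , c-⊥
  codeF ⊤ᶠ = _ , c-⊤
  codeF (s ≈ᶠ t) = _ , c-≈ (proj₂ (codeT s)) (proj₂ (codeT t))
  codeF (rel R ts) = _ , c-rel refl (proj₂ (codeTs ts))
  codeF (¬ᶠ φ) = _ , c-¬ (proj₂ (codeF φ))
  codeF (φ ∧ᶠ ψ) = _ , c-∧ (proj₂ (codeF φ)) (proj₂ (codeF ψ))
  codeF (φ ∨ᶠ ψ) = _ , c-∨ (proj₂ (codeF φ)) (proj₂ (codeF ψ))
  codeF (∀ᶠ x φ) = _ , c-∀ (proj₂ (codeF φ))
  codeF (∃ᶠ x φ) = _ , c-∃ (proj₂ (codeF φ))

  codeV : ∀ v → Σ Tree (CodeV v)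
  codeV 𝐅 = _ , c-𝐅
  codeV 𝐔 = _ , c-𝐔
  codeV 𝐓 = _ , c-𝐓

  codeE : ∀ e → Σ Tree (CodeE e)
  codeE [] = _ , c-[]
  codeE (_ ∷ e) = _ , c-∷ (proj₂ (codeE e))

  codeI : ∀ I → Σ Tree (CodeI I)
  codeI (clo v φ e) = _ , c-clo (proj₂ (codeV v)) (proj₂ (codeF φ)) (proj₂ (codeE e))
  codeI (eqn s t) = _ , c-eqn (proj₂ (codeT s)) (proj₂ (codeT t))
  codeI (und t) = _ , c-und (proj₂ (codeT t))
  codeI (atm v R ds) = _ , c-atm (proj₂ (codeV v)) refl (proj₂ (codeTs (vars ds)))

  mutual
    injT : ∀ {s t a} → CodeT s a → CodeT t a → s ≡ t
    injT c-var c-var = refl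
    injT (c-con p) (c-con q) = cong con (proj₂ Const-countable _ _ (trans p (sym q)))
    injT (c-app p a) (c-app q b) with proj₂ Fun-countable _ _ (trans p (sym q))
    ... | refl = cong (app _) (injTs a b)

    injTs : ∀ {n} {ss ts : Vec Term n} {a} → CodeTs ss a → CodeTs ts a → ss ≡ ts
    injTs c-[] c-[] = refl
    injTs (c-∷ a as) (c-∷ b bs) = cong₂ _∷_ (injT a b) (injTs as bs)

  injF : ∀ {φ ψ a} → CodeF φ a → CodeF ψ a → φ ≡ ψ
  injF c-⊥ c-⊥ = refl
  injF c-⊤ c-⊤ = refl
  injF (c-≈ a b) (c-≈ c d) = cong₂ _≈ᶠ_ (injT a c) (injT b d)
  injF (c-rel p a) (c-rel q b) with proj₂ Rel-countable _ _ (trans p (sym q))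
  ... | refl = cong (rel _) (injTs a b)
  injF (c-¬ a) (c-¬ b) = cong ¬ᶠ_ (injF a b)
  injF (c-∧ a b) (c-∧ c d) = cong₂ _∧ᶠ_ (injF a c) (injF b d)
  injF (c-∨ a b) (c-∨ c d) = cong₂ _∨ᶠ_ (injF a c) (injF b d)
  injF (c-∀ a) (c-∀ b) = cong (∀ᶠ _) (injF a b)
  injF (c-∃ a) (c-∃ b) = cong (∃ᶠ _) (injF a b)

  injV : ∀ {v w a} → CodeV v a → CodeV w a → v ≡ w
  injV c-𝐅 c-𝐅 = refl
  injV c-𝐔 c-𝐔 = refl
  injV c-𝐓 c-𝐓 = refl

  injE : ∀ {e e' a} → CodeE e a → CodeE e' a → e ≡ e'
  injE c-[] c-[] = refl
  injE (c-∷ a) (c-∷ b) = cong (_ ∷_) (injE a b)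

  vars-injective : ∀ {n} (ps qs : Vec ℕ n) → vars ps ≡ vars qs → ps ≡ qs
  vars-injective [] [] eq = refl
  vars-injective (p ∷ ps) (q ∷ qs) eq =
    cong₂ _∷_ (var-injective (cong Vec.head eq)) (vars-injective ps qs (cong Vec.tail eq))
    where
    var-injective : ∀ {x y} → var x ≡ var y → x ≡ y
    var-injective refl = refl

  injI : ∀ {I J a} → CodeI I a → CodeI J a → I ≡ J
  injI (c-clo a b c) (c-clo a' b' c') with injV a a' | injF b b' | injE c c'
  ... | refl | refl | refl = refl
  injI (c-eqn a b) (c-eqn c d) = cong₂ eqn (injT a c) (injT b d)
  injI (c-und a) (c-und b) = cong und (injT a b)
  injI (c-atm a p b) (c-atm a' q b') with injV a a' | proj₂ Rel-countable _ _ (trans p (sym q))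
  ... | refl | refl = cong (atm _ _) (vars-injective _ _ (injTs b b'))

  -- Each item is paired with every index, so that a quantified item meets every parameter in the
  -- course of the enumeration.
  Task-countable : Countable (Item × ℕ)
  Task-countable = encode , injective
    where
    tree : Item × ℕ → Tree
    tree (I , q) = node (proj₁ (codeI I)) (leaf q)
    encode : Item × ℕ → ℕ
    encode = proj₁ Tree-countable ∘ tree
    injective : ∀ a b → encode a ≡ encode b → a ≡ b
    same : ∀ {I J q r a b} → CodeI I a → CodeI J b → node a (leaf q) ≡ node b (leaf r) → (I , q) ≡ (J , r)
    same {q = q} i j refl = cong (_, q) (injI i j)
    injective (I , q) (J , r) eq =
      same (proj₂ (codeI I)) (proj₂ (codeI J)) (proj₂ Tree-countable (tree (I , q)) (tree (J , r)) eq)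

-- Extension of an irrefutable list to a saturated set.

module Saturation (em : ExcludedMiddle 0ℓ) (S : Signature) (Δ : Syntax.IsDefFormulas S)
  (Γ : Syntax.Formula S → Set) (L₀ : List (Tableau.Item S Δ))
  (L₀-consistent : ¬ Tableau.Refutable S Δ Γ L₀) where
  open Syntax S
  open Tableau S Δ
  open ItemCodes S Δ

  Consistent : List Item → Set
  Consistent L = ¬ Refutable Γ L

  HasWitness : Item → ℕ → (Item → Set) → Set
  HasWitness I q H = Σ ℕ λ p → Any (All H) (witnesses I q p)

  Treated : Item → ℕ → List Item → List Item → Set
  Treated I q L L' = Refutable Γ (I ∷ L) ⊎ (I ∈ L' × HasWitness I q (_∈ L'))

  -- Contrapositive of `witness`: if all branches at all parameters were refutable, so would be
  -- those at fresh ones, and hence `L`.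
  supply-witness : ∀ {L I} q → I ∈ L → Consistent L →
    Σ ℕ λ p → Σ (List Item) λ B → B ∈ witnesses I q p × Consistent (B ++ L)
  supply-witness {L} {I} q I∈L cons with em {Σ ℕ λ p → Σ (List Item) λ B → B ∈ witnesses I q p × Consistent (B ++ L)}
  ... | yes w = w
  ... | no none = ⊥-elim (cons (witness q I∈L λ p _ → All.tabulate λ {B} B∈ →
    case em {Refutable Γ (B ++ L)} of λ where
      (yes r) → r
      (no ¬r) → ⊥-elim (none (p , B , B∈ , ¬r))))

  treat : ∀ I q L → Consistent L → Σ (List Item) λ L' → Consistent L' × L ⊆ L' × Treated I q L L'
  treat I q L cons with em {Refutable Γ (I ∷ L)}
  ... | yes r = L , cons , id , inj₁ r
  ... | no ¬r = let p , B , B∈ , cons' = supply-witness q (here refl) ¬r in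
    B ++ I ∷ L , cons' , ∈-++⁺ʳ B ∘ there ,
    inj₂ (∈-++⁺ʳ B (here refl) , p , lose B∈ (All.tabulate ∈-++⁺ˡ))

  Stage : Set
  Stage = Σ (List Item) Consistent

  encode : Item × ℕ → ℕ
  encode = proj₁ Task-countable

  next : ∀ n ((L , _) : Stage) →
    Σ Stage λ (L' , _) → L ⊆ L' × (∀ I q → encode (I , q) ≡ n → Treated I q L L')
  next n (L , cons) with em {Σ (Item × ℕ) λ task → encode task ≡ n}
  ... | no none = (L , cons) , id , λ I q eq → ⊥-elim (none ((I , q) , eq))
  ... | yes ((I , q) , eq) =
    let L' , cons' , L⊆L' , treated = treat I q L cons in
    (L' , cons') , L⊆L' , λ J r eq' →
      subst (λ (J , r) → Treated J r L L') (proj₂ Task-countable (I , q) (J , r) (trans eq (sym eq'))) treated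

  stage : ℕ → Stage
  stage zero = L₀ , L₀-consistent
  stage (suc n) = proj₁ (next n (stage n))

  items : ℕ → List Item
  items = proj₁ ∘ stage

  items-mono : ∀ {m n} → m ≤ n → items m ⊆ items n
  items-mono {n = zero} z≤n = id
  items-mono {m} {suc n} m≤1+n with m≤n⇒m<n∨m≡n m≤1+n
  ... | inj₁ (s≤s m≤n) = proj₁ (proj₂ (next n (stage n))) ∘ items-mono m≤n
  ... | inj₂ refl = id

  H : Item → Set
  H I = Σ ℕ λ n → I ∈ items n

  treated : ∀ I q → Σ ℕ λ n → Treated I q (items n) (items (suc n))
  treated I q = n , proj₂ (proj₂ (next n (stage n))) I q refl
    where
    n : ℕ
    n = encode (I , q)

  conflict : ∀ {I} m n → I ∈ items m → ¬ Refutable Γ (I ∷ items n)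
  conflict m n I∈ r = proj₂ (stage (m ⊔ n)) (refutable-mono
    (λ { (here refl) → items-mono (m≤m⊔n m n) I∈ ; (there p) → items-mono (m≤n⊔m m n) p }) r)

  maximal : ∀ I → H I ⊎ Σ ℕ λ n → Refutable Γ (I ∷ items n)
  maximal I with treated I 0
  ... | n , inj₁ r = inj₂ (n , r)
  ... | n , inj₂ (I∈ , _) = inj₁ (suc n , I∈)

  -- The task may have been treated before `I` entered the set. It was not refused then, since the
  -- refutation would carry over to a later stage containing `I`.
  H-witness : ∀ {I} → H I → ∀ q → HasWitness I q H
  H-witness {I} (m , I∈) q with treated I q
  ... | n , inj₁ r = ⊥-elim (conflict m n I∈ r)
  ... | n , inj₂ (_ , p , w) = p , Any.map (All.map λ J∈ → suc n , J∈) w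

  H-premise : ∀ {φ} → Γ φ → H (clo 𝐓 φ [])
  H-premise {φ} γ with maximal (clo 𝐓 φ [])
  ... | inj₁ h = h
  ... | inj₂ (n , r) = ⊥-elim (proj₂ (stage n) (premise γ r))

  H-initial : ∀ {I} → I ∈ L₀ → H I
  H-initial I∈ = 0 , I∈

  H-branch : ∀ B → All H B ⊎ Σ ℕ λ n → Refutable Γ (B ++ items n)
  H-branch [] = inj₁ []
  H-branch (I ∷ B) with maximal I | H-branch B
  ... | inj₁ h | inj₁ hs = inj₁ (h ∷ hs)
  ... | inj₁ h | inj₂ (n , r) = inj₂ (n , refutable-mono there r)
  ... | inj₂ (n , r) | _ = inj₂ (n , refutable-mono
    (λ { (here p) → here p ; (there p) → there (∈-++⁺ʳ B p) }) r)

  H-branches : ∀ Bs → Any (All H) Bs ⊎ Σ ℕ λ n → All (λ B → Refutable Γ (B ++ items n)) Bs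
  H-branches [] = inj₂ (0 , [])
  H-branches (B ∷ Bs) with H-branch B | H-branches Bs
  ... | inj₁ hs | _ = inj₁ (here hs)
  ... | inj₂ _ | inj₁ h = inj₁ (there h)
  ... | inj₂ (m , r) | inj₂ (n , rs) = inj₂ (m ⊔ n ,
    refutable-mono (++-mono B (items-mono (m≤m⊔n m n))) r ∷ refutable-monos (items-mono (m≤n⊔m m n)) rs)

  H-finite : ∀ P → All H P → Σ ℕ λ n → All (_∈ items n) P
  H-finite [] [] = 0 , []
  H-finite (I ∷ P) ((m , I∈) ∷ hs) = let n , ps = H-finite P hs in m ⊔ n ,
    items-mono (m≤m⊔n m n) I∈ ∷ All.map (items-mono (m≤n⊔m m n)) ps

  -- If no branch lies in `H`, each contains an item refused at some stage. The branches and
  -- premises being finite in number, one stage contains all premises and refutes all branches, so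
  -- `apply` would refute that stage.
  H-rule : ∀ {P Bs} → Rule P Bs → All H P → Any (All H) Bs
  H-rule {P} {Bs} rule hs with H-branches Bs
  ... | inj₁ h = h
  ... | inj₂ (n , rs) = let m , ps = H-finite P hs in ⊥-elim (proj₂ (stage (m ⊔ n))
    (apply rule (All.map (items-mono (m≤m⊔n m n)) ps) (refutable-monos (items-mono (m≤n⊔m m n)) rs)))

-- Order of the truth values and uniqueness of `Val`.

module Values (S : Signature) where
  open Syntax S

  ≤ᵗ-antisym : ∀ {a b} → a ≤ᵗ b → b ≤ᵗ a → a ≡ b
  ≤ᵗ-antisym F≤ F≤ = refl
  ≤ᵗ-antisym U≤U U≤U = refl
  ≤ᵗ-antisym T≤T T≤T = refl

  minᵗ-fix⇒≤ : ∀ v a → minᵗ v a ≡ v → v ≤ᵗ a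
  minᵗ-fix⇒≤ 𝐅 a eq = F≤
  minᵗ-fix⇒≤ 𝐔 𝐔 eq = U≤U
  minᵗ-fix⇒≤ 𝐔 𝐓 eq = U≤T
  minᵗ-fix⇒≤ 𝐓 𝐓 eq = T≤T

  maxᵗ-fix⇒≥ : ∀ v a → maxᵗ v a ≡ v → a ≤ᵗ v
  maxᵗ-fix⇒≥ v 𝐅 eq = F≤
  maxᵗ-fix⇒≥ 𝐔 𝐔 eq = U≤U
  maxᵗ-fix⇒≥ 𝐓 𝐔 eq = U≤T
  maxᵗ-fix⇒≥ 𝐓 𝐓 eq = T≤T

  negᵗ-involutive : ∀ v → negᵗ (negᵗ v) ≡ v
  negᵗ-involutive 𝐅 = refl
  negᵗ-involutive 𝐔 = refl
  negᵗ-involutive 𝐓 = refl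

  module _ (σ : Structure) where
    open Structure σ
    open Sem σ

    private
      clash : ∀ {A B : Set} {m : Maybe A} {a} → m ≡ just a → m ≡ nothing → B
      clash refl ()

    -- `Val` is a relation, so uniqueness has to be proved. It identifies values obtained from
    -- different witnesses and turns a sign other than T into failure of truth.
    Val-det : ∀ {ν φ a b} → Val ν φ a → Val ν φ b → a ≡ b
    Val-det v-F v-F = refl
    Val-det v-T v-T = refl
    Val-det (v-eq-U _) (v-eq-U _) = refl
    Val-det (v-eq-U (inj₁ u)) (v-eq-T p q _) = clash p u
    Val-det (v-eq-U (inj₂ u)) (v-eq-T p q _) = clash q u
    Val-det (v-eq-U (inj₁ u)) (v-eq-F p q _) = clash p u
    Val-det (v-eq-U (inj₂ u)) (v-eq-F p q _) = clash q u
    Val-det (v-eq-T p q _) (v-eq-U (inj₁ u)) = clash p u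
    Val-det (v-eq-T p q _) (v-eq-U (inj₂ u)) = clash q u
    Val-det (v-eq-T p q _) (v-eq-T _ _ _) = refl
    Val-det (v-eq-T p q d≡e) (v-eq-F p' q' d≢e) = ⊥-elim (d≢e
      (trans (just-injective (trans (sym p') p)) (trans d≡e (just-injective (trans (sym q) q')))))
    Val-det (v-eq-F p q _) (v-eq-U (inj₁ u)) = clash p u
    Val-det (v-eq-F p q _) (v-eq-U (inj₂ u)) = clash q u
    Val-det (v-eq-F p q d≢e) (v-eq-T p' q' d≡e) = ⊥-elim (d≢e
      (trans (just-injective (trans (sym p) p')) (trans d≡e (just-injective (trans (sym q') q)))))
    Val-det (v-eq-F p q _) (v-eq-F _ _ _) = refl
    Val-det (v-rel-U _) (v-rel-U _) = refl
    Val-det (v-rel-U u) (v-rel-T p _) = clash p u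
    Val-det (v-rel-U u) (v-rel-F p _) = clash p u
    Val-det (v-rel-T p _) (v-rel-U u) = clash p u
    Val-det (v-rel-T _ _) (v-rel-T _ _) = refl
    Val-det (v-rel-T {R} p r) (v-rel-F q ¬r) =
      ⊥-elim (¬r (subst (relI R) (just-injective (trans (sym p) q)) r))
    Val-det (v-rel-F p _) (v-rel-U u) = clash p u
    Val-det (v-rel-F {R} p ¬r) (v-rel-T q r) =
      ⊥-elim (¬r (subst (relI R) (just-injective (trans (sym q) p)) r))
    Val-det (v-rel-F _ _) (v-rel-F _ _) = refl
    Val-det (v-¬ p) (v-¬ q) = cong negᵗ (Val-det p q)
    Val-det (v-∧ p q) (v-∧ p' q') = cong₂ minᵗ (Val-det p p') (Val-det q q')
    Val-det (v-∨ p q) (v-∨ p' q') = cong₂ maxᵗ (Val-det p p') (Val-det q q')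
    Val-det (v-∀ {a = a} w h (lb , d , wd≡a)) (v-∀ {a = b} w' h' (lb' , d' , w'd'≡b)) = ≤ᵗ-antisym
      (subst (a ≤ᵗ_) (trans (Val-det (h d') (h' d')) w'd'≡b) (lb d'))
      (subst (b ≤ᵗ_) (trans (Val-det (h' d) (h d)) wd≡a) (lb' d))
    Val-det (v-∃ {a = a} w h (ub , d , wd≡a)) (v-∃ {a = b} w' h' (ub' , d' , w'd'≡b)) = ≤ᵗ-antisym
      (subst (_≤ᵗ b) (trans (Val-det (h' d) (h d)) wd≡a) (ub' d))
      (subst (_≤ᵗ a) (trans (Val-det (h d') (h' d')) w'd'≡b) (ub d'))

-- The canonical structure and its truth lemma.

>>=-just : ∀ {A B : Set} {m : Maybe A} {f : A → Maybe B} {a} → m ≡ just a → (m >>= f) ≡ f a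
>>=-just refl = refl

>>=-nothing : ∀ {A B : Set} {m : Maybe A} {f : A → Maybe B} → m ≡ nothing → (m >>= f) ≡ nothing
>>=-nothing refl = refl

least : ExcludedMiddle 0ℓ → (P : ℕ → Set) → Σ ℕ P → Σ ℕ λ m → P m × (∀ k → P k → m ≤ k)
least em P (n , Pn) with search (suc n)
  where
  search : ∀ n → (Σ ℕ λ m → P m × (∀ k → P k → m ≤ k)) ⊎ (∀ k → P k → n ≤ k)
  search zero = inj₂ λ _ _ → z≤n
  search (suc n) with search n
  ... | inj₁ found = inj₁ found
  ... | inj₂ n≤ with em {P n}
  ...   | yes Pn = inj₁ (n , Pn , n≤)
  ...   | no ¬Pn = inj₂ λ k Pk → ≤∧≢⇒< (n≤ k Pk) λ { refl → ¬Pn Pk }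
... | inj₁ found = found
... | inj₂ n< = ⊥-elim (<-irrefl refl (n< n Pn))

module Model (em : ExcludedMiddle 0ℓ) (S : Signature) (Δ : Syntax.IsDefFormulas S)
  (H : Tableau.Item S Δ → Set)
  (H-rule : ∀ {P Bs} → Tableau.Rule S Δ P Bs → All H P → Any (All H) Bs)
  (H-witness : ∀ {I} → H I → ∀ q → Σ ℕ λ p → Any (All H) (Tableau.witnesses S Δ I q p)) where
  open Syntax S
  open IsDefFormulas Δ
  open Logic S Δ
  open Instances S using (↤-≡; ↤-≢)
  open Tableau S Δ
  open Soundness S Δ using (lookup-substTs)
  open Values S

  private
    H-one : ∀ {P I} → Rule P ((I ∷ []) ∷ []) → All H P → H I
    H-one rule hs with H-rule rule hs
    ... | here (h ∷ []) = h

    H-two : ∀ {P I J} → Rule P ((I ∷ []) ∷ (J ∷ []) ∷ []) → All H P → H I ⊎ H J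
    H-two rule hs with H-rule rule hs
    ... | here (h ∷ []) = inj₁ h
    ... | there (here (h ∷ [])) = inj₂ h

    H-none : ∀ {P} {A : Set} → Rule P [] → All H P → A
    H-none rule hs with H-rule rule hs
    ... | ()

    H-map : ∀ {A : Set} {xs : List A} {f : A → List Item} → Any (All H) (map f xs) →
      Σ A λ x → x ∈ xs × All H (f x)
    H-map h with find h
    ... | _ , B∈ , hs with ∈-map⁻ _ B∈
    ...   | x , x∈ , refl = x , x∈ , hs

    H-args : ∀ {n} (ts us : Vec Term n) → (∀ i → H (eqn (lookup ts i) (lookup us i))) →
      All H (map (λ i → eqn (lookup ts i) (lookup us i)) (allFin n))
    H-args ts us hs = All.map⁺ (All.tabulate λ {i} _ → hs i)

    eqn-sym : ∀ {s t} → H (eqn s t) → H (eqn t s)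
    eqn-sym h = H-one r-sym (h ∷ [])

    eqn-trans : ∀ {s t u} → H (eqn s t) → H (eqn t u) → H (eqn s u)
    eqn-trans h h' = H-one r-trans (h ∷ h' ∷ [])

  -- `r-decide` puts `eqn t t` or `und t` into `H`; in the first case the witness of that equation
  -- is a parameter naming the value.
  value : ∀ t → (Σ ℕ λ p → H (eqn t (var p))) ⊎ H (und t)
  value t with H-two r-decide []
  ... | inj₂ u = inj₂ u
  ... | inj₁ h with H-witness h 0
  ...   | p , here (h' ∷ []) = inj₁ (p , h')

  undefined : ∀ t → (∀ p → ¬ H (eqn t (var p))) → H (und t)
  undefined t none with value t
  ... | inj₁ (p , h) = ⊥-elim (none p h)
  ... | inj₂ u = u

  infix 4 _~_
  _~_ : ℕ → ℕ → Set
  p ~ q = H (eqn (var p) (var q))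

  abstract
    leastEqual : ∀ p → Σ ℕ λ m → p ~ m × (∀ k → p ~ k → m ≤ k)
    leastEqual p = least em (p ~_) (p , H-one r-var [])

  rep : ℕ → ℕ
  rep = proj₁ ∘ leastEqual

  ~-rep : ∀ p → p ~ rep p
  ~-rep p = proj₁ (proj₂ (leastEqual p))

  rep-least : ∀ {p k} → p ~ k → rep p ≤ k
  rep-least {p} = proj₂ (proj₂ (leastEqual p)) _

  rep-cong : ∀ {p q} → p ~ q → rep p ≡ rep q
  rep-cong {p} {q} p~q = ≤-antisym (rep-least (eqn-trans p~q (~-rep q)))
    (rep-least (eqn-trans (eqn-sym p~q) (~-rep p)))

  rep-reflects : ∀ {p q} → rep p ≡ rep q → p ~ q
  rep-reflects {p} {q} eq = eqn-trans (subst (p ~_) eq (~-rep p)) (eqn-sym (~-rep q))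

  -- Least representatives stand in for the quotient of the parameters by ~.
  Dom : Set
  Dom = Σ ℕ λ p → rep p ≡ p

  Dom-≡ : {d d' : Dom} → proj₁ d ≡ proj₁ d' → d ≡ d'
  Dom-≡ {p , e} {.p , e'} refl = cong (p ,_) (≡-irrelevant e e')

  ⟦_⟧ : ℕ → Dom
  ⟦ p ⟧ = rep p , sym (rep-cong (~-rep p))

  ⟦⟧-cong : ∀ {p q} → p ~ q → ⟦ p ⟧ ≡ ⟦ q ⟧
  ⟦⟧-cong p~q = Dom-≡ (rep-cong p~q)

  ⟦⟧-proj₁ : ∀ d → ⟦ proj₁ d ⟧ ≡ d
  ⟦⟧-proj₁ (p , eq) = Dom-≡ eq

  toDom : ∀ {t} → (Σ ℕ λ p → H (eqn t (var p))) ⊎ H (und t) → Maybe Dom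
  toDom (inj₁ (p , _)) = just ⟦ p ⟧
  toDom (inj₂ _) = nothing

  params : ∀ {n} → Vec Dom n → Vec ℕ n
  params = Vec.map proj₁

  constant : ∀ c → Σ ℕ λ p → H (eqn (con c) (var p))
  constant c with value (con c)
  ... | inj₁ v = v
  ... | inj₂ u = H-none r-und (H-one r-con [] ∷ u ∷ [])

  σ : Structure
  σ = record
    { D = Dom
    ; d₀ = ⟦ 0 ⟧
    ; conI = λ c → ⟦ proj₁ (constant c) ⟧
    ; funI = λ f ds → toDom (value (app f (vars (params ds))))
    ; relI = λ R ds → H (atm 𝐓 R (params ds))
    }

  open Structure σ using (funI)
  open Sem σ

  Result : Assignment → Env → Term → Set
  Result ν e t = (Σ ℕ λ p → H (eqn (t ∙ e) (var p)) × evalT ν t ≡ just ⟦ p ⟧)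
               ⊎ (H (und (t ∙ e)) × evalT ν t ≡ nothing)

  Results : ∀ {n} → Assignment → Env → Vec Term n → Set
  Results {n} ν e ts =
      (Σ (Vec Dom n) λ ds → (∀ i → H (eqn (lookup ts i ∙ e) (var (lookup (params ds) i))))
                          × evalTs ν ts ≡ just ds)
    ⊎ ((Σ (Fin n) λ i → H (und (lookup ts i ∙ e))) × evalTs ν ts ≡ nothing)

  mutual
    evaluate : ∀ {ν e} t → (∀ x → OccT x t → ν x ≡ ⟦ ⟪ e ⟫ x ⟧) → Result ν e t
    evaluate {e = e} (var x) ν-e = inj₁ (⟪ e ⟫ x , H-one r-var [] , cong just (ν-e x refl))
    evaluate (con c) ν-e = inj₁ (proj₁ (constant c) , proj₂ (constant c) , refl)
    evaluate {ν} {e} (app f ts) ν-e = apply-results (evaluates {e = e} ts ν-e)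
      where
      ts' : Vec Term (funAr f)
      ts' = substTs (var ∘ ⟪ e ⟫) ts
      apply-results : Results ν e ts → Result ν e (app f ts)
      apply-results (inj₁ (ds , hs , eq)) = call _ refl
        where
        fs : Vec Term (funAr f)
        fs = vars (params ds)
        args : ∀ i → H (eqn (lookup ts' i) (lookup fs i))
        args i = subst H (cong₂ eqn (sym (lookup-substTs ts i)) (sym (lookup-map i var (params ds)))) (hs i)
        -- `funI` consults the application to representatives. A value found there passes to
        -- `app f ts'` by `r-cong`; conversely a value of `app f ts'` would pass back, so
        -- undefinedness is inherited too. The equation with `m` ties the case to what `funI`
        -- returns.
        call : ∀ m → value (app f (vars (params ds))) ≡ m → Result ν e (app f ts)
        call (inj₁ (p , h)) eq' = inj₁ (p , H-one r-cong (h ∷ H-args fs ts' λ i → eqn-sym (args i)) ,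
          trans (>>=-just eq) (cong toDom eq'))
        call (inj₂ u) eq' = inj₂
          ( undefined (app f ts') (λ p h → H-none r-und (H-one r-cong (h ∷ H-args ts' fs args) ∷ u ∷ []))
          , trans (>>=-just eq) (cong toDom eq'))
      apply-results (inj₂ ((i , u) , eq)) = inj₂
        ( undefined (app f ts') (λ p h → H-none (r-arg i)
            (h ∷ subst (H ∘ und) (sym (lookup-substTs ts i)) u ∷ []))
        , >>=-nothing eq)

    evaluates : ∀ {n ν e} (ts : Vec Term n) → (∀ x → OccTs x ts → ν x ≡ ⟦ ⟪ e ⟫ x ⟧) → Results ν e ts
    evaluates [] ν-e = inj₁ ([] , (λ ()) , refl)
    evaluates {e = e} (t ∷ ts) ν-e =
      cons-result {e = e} (evaluate {e = e} t (λ x → ν-e x ∘ inj₁)) (evaluates {e = e} ts (λ x → ν-e x ∘ inj₂))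

    cons-result : ∀ {n ν e t} {ts : Vec Term n} → Result ν e t → Results ν e ts → Results ν e (t ∷ ts)
    cons-result (inj₂ (u , eq)) _ = inj₂ ((zero , u) , >>=-nothing eq)
    cons-result (inj₁ (p , h , eq)) (inj₂ ((i , u) , eqs)) =
      inj₂ ((suc i , u) , trans (>>=-just eq) (>>=-nothing eqs))
    cons-result (inj₁ (p , h , eq)) (inj₁ (ds , hs , eqs)) =
      inj₁ (⟦ p ⟧ ∷ ds , (λ { zero → eqn-trans h (~-rep p) ; (suc i) → hs i }) ,
        trans (>>=-just eq) (>>=-just eqs))

  Agree : Assignment → Env → Formula → Set
  Agree ν e φ = ∀ x → Free x φ → ν x ≡ ⟦ ⟪ e ⟫ x ⟧

  private
    agree-binder : ∀ {ν e x p d} φ → (∀ y → y ≢ x × Free y φ → ν y ≡ ⟦ ⟪ e ⟫ y ⟧) →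
      d ≡ ⟦ p ⟧ → Agree (ν [ x ≔ d ]ᵃ) ((x , p) ∷ e) φ
    agree-binder {e = e} {x} φ ν-e d≡p y o with y ≟ x
    ... | yes refl = trans (if-≡ {x = y} refl) (trans d≡p (cong ⟦_⟧ (sym (↤-≡ ⟪ e ⟫ y))))
    ... | no y≢x = trans (if-≢ y≢x) (trans (ν-e y (y≢x , o)) (cong ⟦_⟧ (sym (↤-≢ {⟪ e ⟫} y≢x))))

    named-dom : ∀ {d p} → H (eqn (var (proj₁ d)) (var p)) → d ≡ ⟦ p ⟧
    named-dom {d} h = trans (sym (⟦⟧-proj₁ d)) (⟦⟧-cong h)

  truth-≈ : ∀ {v s t e ν} → H (clo v (s ≈ᶠ t) e) → Result ν e s → Result ν e t → Val ν (s ≈ᶠ t) v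
  truth-≈ {𝐓} h (inj₁ (p , hp , ep)) (inj₁ (q , hq , eq)) =
    v-eq-T ep eq (⟦⟧-cong (eqn-trans (eqn-sym hp) (eqn-trans (H-one r-≈T (h ∷ [])) hq)))
  truth-≈ {𝐅} h (inj₁ (p , hp , ep)) (inj₁ (q , hq , eq)) =
    v-eq-F ep eq λ p≡q → H-none r-≈F
      (h ∷ eqn-trans hp (eqn-trans (rep-reflects {p} {q} (cong proj₁ p≡q)) (eqn-sym hq)) ∷ [])
  truth-≈ {𝐔} h (inj₁ (p , hp , ep)) (inj₁ (q , hq , eq)) =
    [ (λ u → H-none r-und (hp ∷ u ∷ [])) , (λ u → H-none r-und (hq ∷ u ∷ [])) ] (H-two r-≈U (h ∷ []))
  truth-≈ {𝐔} h (inj₂ (u , eu)) _ = v-eq-U (inj₁ eu)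
  truth-≈ {𝐓} h (inj₂ (u , eu)) _ = H-none (r-≈ˡ λ ()) (h ∷ u ∷ [])
  truth-≈ {𝐅} h (inj₂ (u , eu)) _ = H-none (r-≈ˡ λ ()) (h ∷ u ∷ [])
  truth-≈ {𝐔} h (inj₁ _) (inj₂ (u , eu)) = v-eq-U (inj₂ eu)
  truth-≈ {𝐓} h (inj₁ _) (inj₂ (u , eu)) = H-none (r-≈ʳ λ ()) (h ∷ u ∷ [])
  truth-≈ {𝐅} h (inj₁ _) (inj₂ (u , eu)) = H-none (r-≈ʳ λ ()) (h ∷ u ∷ [])

  truth-rel : ∀ {v R ts e ν} → H (clo v (rel R ts) e) → Results ν e ts → Val ν (rel R ts) v
  truth-rel {𝐓} h (inj₁ (ds , hs , eq)) =
    v-rel-T eq (H-one (r-rel λ ()) (h ∷ All.map⁺ (All.tabulate λ {i} _ → hs i)))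
  truth-rel {𝐅} h (inj₁ (ds , hs , eq)) =
    v-rel-F eq λ h' → H-none (r-atm {v = 𝐓} {𝐅} λ ())
      (h' ∷ H-one (r-rel λ ()) (h ∷ All.map⁺ (All.tabulate λ {i} _ → hs i)) ∷ [])
  truth-rel {𝐔} h (inj₁ (ds , hs , eq)) with H-map (H-rule r-relU (h ∷ []))
  ... | i , _ , u ∷ [] = H-none r-und (hs i ∷ u ∷ [])
  truth-rel {𝐔} h (inj₂ ((i , u) , eq)) = v-rel-U eq
  truth-rel {𝐓} h (inj₂ ((i , u) , eq)) = H-none (r-rel-arg i λ ()) (h ∷ u ∷ [])
  truth-rel {𝐅} h (inj₂ ((i , u) , eq)) = H-none (r-rel-arg i λ ()) (h ∷ u ∷ [])

  Truth : Formula → Set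
  Truth φ = ∀ {v e ν} → H (clo v φ e) → Agree ν e φ → Val ν φ v

  truth-∀ : ∀ {x φ v e ν} → Truth φ → H (clo v (∀ᶠ x φ) e) → Agree ν e (∀ᶠ x φ) → Val ν (∀ᶠ x φ) v
  truth-∀ {x} {φ} {v} {e} {ν} truth-φ h ν-e = v-∀ (proj₁ ∘ instance-at) (proj₁ ∘ proj₂ ∘ instance-at)
    (proj₂ ∘ proj₂ ∘ instance-at , attained (H-witness h 0))
    where
    instance-at : ∀ d → Σ TV λ a → Val (ν [ x ≔ d ]ᵃ) φ a × v ≤ᵗ a
    instance-at d with H-witness h (suc (proj₁ d))
    ... | p , hp with H-map hp
    ...   | a , a∈ , d~p ∷ hφ ∷ [] = a , truth-φ hφ (agree-binder {e = e} φ ν-e (named-dom d~p)) ,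
            minᵗ-fix⇒≤ v a (∈-fixers⁻ minᵗ a a∈)
    attained : (Σ ℕ λ p → Any (All H) (witnesses (clo v (∀ᶠ x φ) e) 0 p)) →
      Σ Dom λ d → proj₁ (instance-at d) ≡ v
    -- `instance-at` evaluates `⟦ p ⟧` through a name of its own, in general other than `p`;
    -- uniqueness of values shows that it finds `v` as well.
    attained (p , here (hφ ∷ [])) = ⟦ p ⟧ ,
      Val-det σ (proj₁ (proj₂ (instance-at ⟦ p ⟧))) (truth-φ hφ (agree-binder {e = e} φ ν-e refl))

  truth-∃ : ∀ {x φ v e ν} → Truth φ → H (clo v (∃ᶠ x φ) e) → Agree ν e (∃ᶠ x φ) → Val ν (∃ᶠ x φ) v
  truth-∃ {x} {φ} {v} {e} {ν} truth-φ h ν-e = v-∃ (proj₁ ∘ instance-at) (proj₁ ∘ proj₂ ∘ instance-at)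
    (proj₂ ∘ proj₂ ∘ instance-at , attained (H-witness h 0))
    where
    instance-at : ∀ d → Σ TV λ a → Val (ν [ x ≔ d ]ᵃ) φ a × a ≤ᵗ v
    instance-at d with H-witness h (suc (proj₁ d))
    ... | p , hp with H-map hp
    ...   | a , a∈ , d~p ∷ hφ ∷ [] = a , truth-φ hφ (agree-binder {e = e} φ ν-e (named-dom d~p)) ,
            maxᵗ-fix⇒≥ v a (∈-fixers⁻ maxᵗ a a∈)
    attained : (Σ ℕ λ p → Any (All H) (witnesses (clo v (∃ᶠ x φ) e) 0 p)) →
      Σ Dom λ d → proj₁ (instance-at d) ≡ v
    attained (p , here (hφ ∷ [])) = ⟦ p ⟧ ,
      Val-det σ (proj₁ (proj₂ (instance-at ⟦ p ⟧))) (truth-φ hφ (agree-binder {e = e} φ ν-e refl))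

  truth : ∀ φ → Truth φ
  truth ⊥ᶠ {𝐅} h ν-e = v-F
  truth ⊥ᶠ {𝐔} h ν-e = H-none (r-⊥ λ ()) (h ∷ [])
  truth ⊥ᶠ {𝐓} h ν-e = H-none (r-⊥ λ ()) (h ∷ [])
  truth ⊤ᶠ {𝐅} h ν-e = H-none (r-⊤ λ ()) (h ∷ [])
  truth ⊤ᶠ {𝐔} h ν-e = H-none (r-⊤ λ ()) (h ∷ [])
  truth ⊤ᶠ {𝐓} h ν-e = v-T
  truth (s ≈ᶠ t) {e = e} h ν-e =
    truth-≈ h (evaluate {e = e} s (λ x → ν-e x ∘ inj₁)) (evaluate {e = e} t (λ x → ν-e x ∘ inj₂))
  truth (rel R ts) {e = e} h ν-e = truth-rel h (evaluates {e = e} ts ν-e)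
  truth (¬ᶠ φ) {v} {ν = ν} h ν-e = subst (Val ν (¬ᶠ φ)) (negᵗ-involutive v)
    (v-¬ (truth φ (H-one r-¬ (h ∷ [])) ν-e))
  truth (φ ∧ᶠ ψ) {v} {ν = ν} h ν-e with H-map (H-rule r-∧ (h ∷ []))
  ... | (a , b) , ab∈ , hφ ∷ hψ ∷ [] =
    subst (Val ν (φ ∧ᶠ ψ)) (∈-preimage₂⁻ minᵗ a b ab∈)
      (v-∧ (truth φ hφ λ x → ν-e x ∘ inj₁) (truth ψ hψ λ x → ν-e x ∘ inj₂))
  truth (φ ∨ᶠ ψ) {v} {ν = ν} h ν-e with H-map (H-rule r-∨ (h ∷ []))
  ... | (a , b) , ab∈ , hφ ∷ hψ ∷ [] =
    subst (Val ν (φ ∨ᶠ ψ)) (∈-preimage₂⁻ maxᵗ a b ab∈)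
      (v-∨ (truth φ hφ λ x → ν-e x ∘ inj₁) (truth ψ hψ λ x → ν-e x ∘ inj₂))
  truth (∀ᶠ x φ) h ν-e = truth-∀ (truth φ) h ν-e
  truth (∃ᶠ x φ) h ν-e = truth-∃ (truth φ) h ν-e

  enumerate : ∀ {n} → ℕ → Vec ℕ n → Env
  enumerate k [] = []
  enumerate k (p ∷ ps) = (k , p) ∷ enumerate (suc k) ps

  enumerate-lookup : ∀ {n} k (ps : Vec ℕ n) i → ⟪ enumerate k ps ⟫ (k + toℕ i) ≡ lookup ps i
  enumerate-lookup k (p ∷ ps) zero = if-≡ {x = k} (+-identityʳ k)
  enumerate-lookup k (p ∷ ps) (suc i) = trans (if-≢ (m+1+n≢m k))
    (trans (cong ⟪ enumerate (suc k) ps ⟫ (+-suc k (toℕ i))) (enumerate-lookup (suc k) ps i))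

  -- `r-δT` and `r-δ¬` are the two directions. An undefined application puts sign F or U for `δ f`
  -- into `H`, and the truth lemma for `δ f` then contradicts its being true.
  satδ : Satδ σ
  satδ f ds ν ν-ds = to , from
    where
    e : Env
    e = enumerate 0 (params ds)
    represents : Represents e (params ds)
    represents = enumerate-lookup 0 (params ds)
    agree : Agree ν e (δ f)
    agree x o = subst (λ y → ν y ≡ ⟦ ⟪ e ⟫ y ⟧) (toℕ-fromℕ< x<n)
      (trans (ν-ds i) (sym (trans (cong ⟦_⟧ (trans (represents i) (lookup-map i proj₁ ds)))
        (⟦⟧-proj₁ (lookup ds i)))))
      where
      x<n : x < funAr f
      x<n = δ-free f x o
      i : Fin (funAr f)
      i = fromℕ< x<n
    to : Val ν (δ f) 𝐓 → Σ Dom λ d → funI f ds ≡ just d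
    to val with value (app f (vars (params ds)))
    ... | inj₁ (p , _) = ⟦ p ⟧ , refl
    ... | inj₂ u with H-two (r-δ¬ {e = e} represents) (u ∷ [])
    ...   | inj₁ h = case Val-det σ val (truth (δ f) h agree) of λ ()
    ...   | inj₂ h = case Val-det σ val (truth (δ f) h agree) of λ ()
    from : (Σ Dom λ d → funI f ds ≡ just d) → Val ν (δ f) 𝐓
    from defined with value (app f (vars (params ds))) | defined
    ... | inj₁ (p , h) | _ = truth (δ f) (H-one (r-δT {e = e} represents) (h ∷ [])) agree
    ... | inj₂ _ | _ , ()

  canonical-model : ∀ Γ → (∀ φ → Γ φ → H (clo 𝐓 φ [])) →
    Σ Structure λ σ → Σ (Var → Structure.D σ) λ ν →
    IsModel Γ σ ν × (∀ v φ → H (clo v φ []) → Sem.Val σ ν φ v)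
  canonical-model Γ premises = σ , base , (satδ , λ χ γ → holds 𝐓 χ (premises χ γ)) , holds
    where
    base : Assignment
    base x = ⟦ x + x ⟧
    holds : ∀ v φ → H (clo v φ []) → Val base φ v
    holds v φ h = truth φ h λ _ _ → refl

-- Model existence and completeness.

module Completeness (em : ExcludedMiddle 0ℓ) (S : Signature) (Δ : Syntax.IsDefFormulas S)
  (Γ : Logic.FSet S Δ) where
  open Syntax S
  open Logic S Δ
  open DerivedRules S Δ
  open Instances S
  open Tableau S Δ
  open Soundness S Δ
  open Values S

  consistent⇒model : ∀ {L} → ¬ Refutable Γ L → Σ Structure λ σ → Σ (Var → Structure.D σ) λ ν →
    IsModel Γ σ ν × (∀ {v φ} → clo v φ [] ∈ L → Sem.Val σ ν φ v)
  consistent⇒model {L} cons =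
    let σ , ν , M , vals = Model.canonical-model em S Δ H H-rule H-witness Γ (λ φ → H-premise {φ}) in
    σ , ν , M , λ {v} {φ} φ∈ → vals v φ (H-initial φ∈)
    where open Saturation em S Δ Γ L cons

  -- Halving sends the even parameter of a variable back to it. Its values at odd parameters are
  -- harmless, since each fresh parameter is reassigned when it is introduced.
  half-base : Base ⌊_/2⌋
  half-base i = sym (n≡⌊n+n/2⌋ i)

  refutable⇒⊢ : ∀ {v φ} → Refutable Γ (clo v φ [] ∷ []) → Γ ∪ ｛ signed v φ ｝ ⊢ ⊥ᶠ
  refutable⇒⊢ {v} {φ} r =
    let G , Γ-G , k = refutable-sound r in
    weaken (λ { χ (here eq) → inj₂ eq ; χ (there χ∈G) → inj₁ (All.lookup Γ-G χ∈G) })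
      (k ⌊_/2⌋ (signed v φ ∷ G) half-base
        ((φ , Inst-id φ (λ x _ → half-base x) , hyp₀) ∷ [])
        (All.tabulate (hyp ∘ there)))

  model-existence : ¬ (Γ ⊢ ⊥ᶠ) → HasModel Γ
  model-existence Γ⊬⊥ with em {Refutable Γ []}
  ... | no cons = let σ , ν , M , _ = consistent⇒model cons in σ , ν , M
  ... | yes r = let G , Γ-G , k = refutable-sound r in
    ⊥-elim (Γ⊬⊥ (weaken (λ χ → All.lookup Γ-G) (k ⌊_/2⌋ G half-base [] (All.tabulate hyp))))

  completeness : ∀ φ → Γ ⊨ φ → Γ ⊢ φ
  completeness φ Γ⊨φ = P3 (weaken (λ χ ()) (C1 {φ}))
    (∨-E (∨-E (weaken (λ χ → inj₂) P1) (refute 𝐅 λ ())) (refute 𝐔 λ ()))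
    where
    refute : ∀ v → v ≢ 𝐓 → Γ ∪ ｛ signed v φ ｝ ⊢ φ
    refute v v≢T with em {Refutable Γ (clo v φ [] ∷ [])}
    ... | yes r = P3 (refutable⇒⊢ r) (weaken (λ χ → inj₂) C2)
    ... | no cons = let σ , ν , M , vals = consistent⇒model cons in
      ⊥-elim (v≢T (Val-det σ (vals (here refl)) (Γ⊨φ σ ν M)))

theorem7p9 : ExcludedMiddle 0ℓ → (S : Signature) (Δ : Syntax.IsDefFormulas S) →
    (Γ : Logic.FSet S Δ) (φ : Syntax.Formula S) →
    (¬ (Logic._⊢_ S Δ Γ (Syntax.⊥ᶠ)) → Logic.HasModel S Δ Γ) × (Logic._⊨_ S Δ Γ φ → Logic._⊢_ S Δ Γ φ)
theorem7p9 em S Δ Γ φ = model-existence , completeness φ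
  where open Completeness em S Δ Γ
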